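{- For any normalised eliminator $e:\Gamma\multimap_e\Delta$ (with $\Theta,\Delta,\Xi\vdash t:A$, so that $\Theta,\Gamma,\Xi\vdash\mathrm{let}\ e\ \mathrm{in}\ t:A$), we have $[\![\mathrm{let}\ e\ \mathrm{in}\ t:A]\!]=[\![t]\!]$, where $[\![-]\!]$ is the interpretation of the annotated language in a categorical model.
   Context: Fix a set $\mathbf{Q}$ of qubits and a set $\mathbf{G}$ of gates; each gate $G$ comes with a tuple $(q_1,\dots,q_n)$ of distinct qubits and a duration $d\in\mathbb{R}_{\ge0}$; write $(G,d,q_1,\dots,q_n)\in\mathbf{G}$. **Annotated language.** Types: $A,B::=1\mid q\mid A\otimes B\mid \Box_d A$ ($q\in\mathbf{Q}$, $d\in\mathbb{R}$). Contexts: lists of graded declarations $x:^d A$, $d\in\mathbb{R}$. $d+\Gamma$ adds $d$ to every grade of $\Gamma$. Typing rules: - Swap: from $\Gamma,x:^dA,y:^eB,\Delta\vdash t:C$ infer $\Gamma,y:^eB,x:^dA,\Delta\vdash t:C$. - Var: $x:^0A\vdash x:A$. Unit-I: $\vdash *:1$. - Unit-E: from $\Gamma\vdash s:1$, $\Delta\vdash t:A$ infer $d+\Gamma,\Delta\vdash\mathrm{let}\ *=s\ \mathrm{in}\ t:A$. - Gate: for $(G,d,q_1,\dots,q_n)\in\mathbf{G}$, from $\Gamma_i\vdash t_i:q_i$ infer $-d+\Gamma_1,\dots,-d+\Gamma_n\vdash G(t_1,\dots,t_n):q_1\otimes\cdots\otimes q_n$. - Tens-I: from $\Gamma\vdash s:A$,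 $\Delta\vdash t:B$ infer $\Gamma,\Delta\vdash(s,t):A\otimes B$. - Tens-E: from $\Gamma\vdash s:A\otimes B$ and $x:^dA,y:^dB,\Delta\vdash t:C$ infer $d+\Gamma,\Delta\vdash\mathrm{let}\ (x,y)=s\ \mathrm{in}\ t:C$. - Box-I: from $\Gamma\vdash t:A$ infer $d+\Gamma\vdash\mathrm{box}\ d\ t:\Box_dA$. - Box-E: from $\Gamma\vdash s:\Box_dA$ and $x:^eA,\Delta\vdash t:B$ infer $(e-d)+\Gamma,\Delta\vdash\mathrm{let\ box}\ d\ x=s\ \mathrm{in}\ t:B$. - Delay: from $\Gamma\vdash t:q$, $d\ge0$ infer $-d+\Gamma\vdash\mathrm{delay}_d(t):q$. - Let: from $\Gamma\vdash s:A$ and $x:^dA,\Delta\vdash t:C$ infer $d+\Gamma,\Delta\vdash\mathrm{let}\ x=s\ \mathrm{in}\ t:C$. **Normalised eliminators.** The relation $e:\Gamma\multimap_e\Delta$ has the instances - $(*=x):(x:^d1)\multimap_e[]$; - $((x,y)=z):(z:^d(A\otimes B))\multimap_e(x:^dA,\,y:^dB)$; - $(\mathrm{box}\ e'\ x=z):(z:^d\Box_{e'}A)\multimap_e(x:^{d+e'}A)$. For $e:\Gamma\multimap_e\Delta$, from $\Theta,\Delta,\Xi\vdash t:A$ one infers $\Theta,\Gamma,\Xi\vdash\mathrm{let}\ e\ \mathrm{in}\ t:A$ (the corresponding elimination rule applied to a variable, up to Swap). **Categorical model of the annotated language.** This consists of: a symmetric monoidal category $\mathcal{C}^\otimes$ with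 unit $I$; for every $q\in\mathbf{Q}$ an object $X_q$; a monoidal functor $\mathrm{Shift}(-)$ from the discrete category of real numbers (monoidal under $+$) to the category of symmetric monoidal endofunctors of $\mathcal{C}^\otimes$ (so there are coherent natural isomorphisms $\mathrm{Shift}(0)(X)\simeq X$, $\mathrm{Shift}(d_1+d_2)(X)\simeq\mathrm{Shift}(d_1)(\mathrm{Shift}(d_2)(X))$, $\mathrm{Shift}(d)(I)\simeq I$, $\mathrm{Shift}(d)(X\otimes Y)\simeq\mathrm{Shift}(d)(X)\otimes\mathrm{Shift}(d)(Y)$); for every gate $(G,d,q_1,\dots,q_n)$ a morphism $f_G:\mathrm{Shift}(-d)(\bigotimes_iX_{q_i})\to\bigotimes_iX_{q_i}$; for every $x\in\mathbb{R}$ and $q\in\mathbf{Q}$ a morphism $\mathrm{delay}_x:\mathrm{Shift}(-x)(X_q)\to X_q$. **Interpretation.** $[\![1]\!]:=I$, $[\![q]\!]:=X_q$, $[\![A\otimes B]\!]:=[\![A]\!]\otimes[\![B]\!]$, $[\![\Box_dA]\!]:=\mathrm{Shift}(d)[\![A]\!]$; $[\![[]]\!]:=I$, $[\![x:^dA,\Gamma]\!]:=\mathrm{Shift}(d)[\![A]\!]\otimes[\![\Gamma]\!]$, so that $[\![d+\Gamma]\!]\simeq\mathrm{Shift}(d)[\![\Gamma]\!]$. A derivation of $\Gamma\vdash t:A$ is interpreted as a morphism $[\![t]\!]:[\![\Gamma]\!]\to[\![A]\!]$, by induction, with coherence isomorphisms inserted where appropriate: Swap is composition with the symmetry; Var and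 Unit-I are identities; Unit-E is $\mathrm{Shift}(d)[\![s]\!]\otimes[\![t]\!]$; Tens-I is $[\![s]\!]\otimes[\![t]\!]$; Tens-E and Let are $[\![t]\!]\circ(\mathrm{Shift}(d)[\![s]\!]\otimes\mathrm{id})$; Gate is $f_G\circ\mathrm{Shift}(-d)(\bigotimes_i[\![t_i]\!])$; Delay is $\mathrm{delay}_d\circ\mathrm{Shift}(-d)[\![t]\!]$; Box-I is $\mathrm{Shift}(d)[\![t]\!]$; Box-E is $[\![t]\!]\circ(\mathrm{Shift}(e-d)[\![s]\!]\otimes\mathrm{id})$. -}

module Defs where

open import Level using (Level; _⊔_; 0ℓ) renaming (suc to lsuc)
open import Algebra.Bundles using (Monoid; AbelianGroup)
open import Data.List.Base using (List; []; _∷_; _++_; map)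
open import Data.List.Relation.Binary.Pointwise using (Pointwise; []; _∷_)
import Data.List.Relation.Binary.Pointwise as Pointwise
open import Data.List.Relation.Unary.Unique.Propositional using (Unique)
open import Data.Nat.Base as ℕ using (ℕ)
import Data.Nat.Properties as ℕ
open import Data.Product.Base using (∃; _,_)
open import Data.Rational.Base as ℚ using (ℚ; 0ℚ; 1ℚ; ½)
import Data.Rational.Properties as ℚ
open import Data.Unit.Base using (⊤; tt)
open import Relation.Binary.Bundles using (Setoid)
open import Relation.Binary.Core using (Rel)
open import Relation.Binary.Structures using (IsEquivalence)
open import Relation.Binary.PropositionalEquality using (_≡_; refl; sym; trans; cong; subst)
open import Relation.Binary.Construct.Closure.ReflexiveTransitive using (Star; _◅_; _◅◅_; gmap) renaming (ε to done)
import Relation.Binary.Reasoning.Setoid as SetoidReasoning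

-- Real numbers as Cauchy sequences of rationals.  Equality of reals is _≃_, not _≡_.

module Real where

  infix 4 _≃_ _≤_
  infixl 6 _+_ _-_
  infix 8 -_

  record ℝ : Set where
    no-eta-equality
    field
      seq    : ℕ → ℚ
      cauchy : ∀ ε → 0ℚ ℚ.< ε → ∃ λ N → ∀ m n → N ℕ.≤ m → N ℕ.≤ n →
               ℚ.∣ seq m ℚ.- seq n ∣ ℚ.< ε
  open ℝ public

  record _≃_ (x y : ℝ) : Set where
    constructor mk≃
    field
      close : ∀ ε → 0ℚ ℚ.< ε → ∃ λ N → ∀ n → N ℕ.≤ n →
              ℚ.∣ seq x n ℚ.- seq y n ∣ ℚ.< ε
  open _≃_ public

  record _≤_ (x y : ℝ) : Set where
    constructor mk≤
    field
      below : ∀ ε → 0ℚ ℚ.< ε → ∃ λ N → ∀ n → N ℕ.≤ n →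
              seq x n ℚ.≤ seq y n ℚ.+ ε
  open _≤_ public

  private
    module Q where
      open import Data.Rational.Solver using (module +-*-Solver)
      open +-*-Solver using (solve; _:=_; _:+_; _:-_; :-_)
      open import Data.Rational.Base using (_<_; _*_; _+_; _-_; -_; ∣_∣)

      half>0 : ∀ {ε} → 0ℚ < ε → 0ℚ < ½ * ε
      half>0 {ε} p = subst (_< ½ * ε) (ℚ.*-zeroʳ ½) (ℚ.*-monoʳ-<-pos ½ p)

      half+half : ∀ ε → ½ * ε + ½ * ε ≡ ε
      half+half ε = trans (sym (ℚ.*-distribʳ-+ ε ½ ½)) (ℚ.*-identityˡ ε)

      triangle : ∀ {ε} a b → ∣ a ∣ < ½ * ε → ∣ b ∣ < ½ * ε → ∣ a + b ∣ < ε
      triangle {ε} a b p q = ℚ.≤-<-trans (ℚ.∣p+q∣≤∣p∣+∣q∣ a b)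
        (subst (∣ a ∣ + ∣ b ∣ <_) (half+half ε) (ℚ.+-mono-< p q))

      add : ∀ {ε} a b c d → ∣ a - c ∣ < ½ * ε → ∣ b - d ∣ < ½ * ε →
            ∣ (a + b) - (c + d) ∣ < ε
      add {ε} a b c d p q = subst (λ z → ∣ z ∣ < ε)
        (solve 4 (λ a b c d → (a :- c) :+ (b :- d) := (a :+ b) :- (c :+ d)) refl a b c d)
        (triangle (a - c) (b - d) p q)

      via : ∀ {ε} a b c → ∣ a - b ∣ < ½ * ε → ∣ b - c ∣ < ½ * ε → ∣ a - c ∣ < ε
      via {ε} a b c p q = subst (λ z → ∣ z ∣ < ε)
        (solve 3 (λ a b c → (a :- b) :+ (b :- c) := a :- c) refl a b c)
        (triangle (a - b) (b - c) p q)

      flip : ∀ {ε} a b → ∣ a - b ∣ < ε → ∣ b - a ∣ < ε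
      flip {ε} a b = subst (_< ε) (trans (sym (ℚ.∣-p∣≡∣p∣ (a - b)))
        (cong ∣_∣ (solve 2 (λ a b → :- (a :- b) := b :- a) refl a b)))

      neg : ∀ {ε} a b → ∣ a - b ∣ < ε → ∣ (- a) - (- b) ∣ < ε
      neg {ε} a b p = subst (λ z → ∣ z ∣ < ε)
        (solve 2 (λ a b → b :- a := (:- a) :- (:- b)) refl a b) (flip a b p)

      same : ∀ {ε} → 0ℚ < ε → ∀ {a b} → a ≡ b → ∣ a - b ∣ < ε
      same {ε} p {a} refl = subst (λ z → ∣ z ∣ < ε) (sym (ℚ.+-inverseʳ a)) p

    maxˡ : ∀ {M N n} → M ℕ.⊔ N ℕ.≤ n → M ℕ.≤ n
    maxˡ {M} {N} = ℕ.≤-trans (ℕ.m≤m⊔n M N)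

    maxʳ : ∀ {M N n} → M ℕ.⊔ N ℕ.≤ n → N ℕ.≤ n
    maxʳ {M} {N} = ℕ.≤-trans (ℕ.m≤n⊔m M N)

  0ℝ : ℝ
  0ℝ .seq _ = 0ℚ
  0ℝ .cauchy ε p = 0 , λ _ _ _ _ → Q.same p {0ℚ} refl

  _+_ : ℝ → ℝ → ℝ
  (x + y) .seq n = seq x n ℚ.+ seq y n
  (x + y) .cauchy ε p =
    let (M , f) = cauchy x (½ ℚ.* ε) (Q.half>0 p)
        (N , g) = cauchy y (½ ℚ.* ε) (Q.half>0 p)
    in M ℕ.⊔ N , λ m n M≤ N≤ → Q.add (seq x m) (seq y m) (seq x n) (seq y n)
         (f m n (maxˡ M≤) (maxˡ N≤)) (g m n (maxʳ {M} M≤) (maxʳ {M} N≤))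

  -_ : ℝ → ℝ
  (- x) .seq n = ℚ.- seq x n
  (- x) .cauchy ε p =
    let (N , f) = cauchy x ε p
    in N , λ m n N≤m N≤n → Q.neg (seq x m) (seq x n) (f m n N≤m N≤n)

  _-_ : ℝ → ℝ → ℝ
  x - y = x + - y

  pointwise : ∀ {x y} → (∀ n → seq x n ≡ seq y n) → x ≃ y
  pointwise h .close ε p = 0 , λ n _ → Q.same p (h n)

  ≃-refl : ∀ {x} → x ≃ x
  ≃-refl = pointwise (λ _ → refl)

  ≃-sym : ∀ {x y} → x ≃ y → y ≃ x
  ≃-sym {x} {y} h .close ε p =
    let (N , f) = close h ε p in N , λ n N≤n → Q.flip (seq x n) (seq y n) (f n N≤n)

  ≃-trans : ∀ {x y z} → x ≃ y → y ≃ z → x ≃ z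
  ≃-trans {x} {y} {z} h k .close ε p =
    let (M , f) = close h (½ ℚ.* ε) (Q.half>0 p)
        (N , g) = close k (½ ℚ.* ε) (Q.half>0 p)
    in M ℕ.⊔ N , λ n M≤ → Q.via (seq x n) (seq y n) (seq z n)
         (f n (maxˡ M≤)) (g n (maxʳ {M} M≤))

  +-cong : ∀ {x y u v} → x ≃ y → u ≃ v → x + u ≃ y + v
  +-cong {x} {y} {u} {v} h k .close ε p =
    let (M , f) = close h (½ ℚ.* ε) (Q.half>0 p)
        (N , g) = close k (½ ℚ.* ε) (Q.half>0 p)
    in M ℕ.⊔ N , λ n M≤ → Q.add (seq x n) (seq u n) (seq y n) (seq v n)
         (f n (maxˡ M≤)) (g n (maxʳ {M} M≤))

  -‿cong : ∀ {x y} → x ≃ y → - x ≃ - y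
  -‿cong {x} {y} h .close ε p =
    let (N , f) = close h ε p in N , λ n N≤n → Q.neg (seq x n) (seq y n) (f n N≤n)

  +-0-abelianGroup : AbelianGroup 0ℓ 0ℓ
  +-0-abelianGroup = record
    { Carrier = ℝ ; _≈_ = _≃_ ; _∙_ = _+_ ; ε = 0ℝ ; _⁻¹ = -_
    ; isAbelianGroup = record
      { isGroup = record
        { isMonoid = record
          { isSemigroup = record
            { isMagma = record
              { isEquivalence = record { refl = ≃-refl ; sym = ≃-sym ; trans = ≃-trans }
              ; ∙-cong = +-cong
              }
            ; assoc = λ x y z → pointwise λ n → ℚ.+-assoc (seq x n) (seq y n) (seq z n)
            }
          ; identity = (λ x → pointwise λ n → ℚ.+-identityˡ (seq x n))
                     , (λ x → pointwise λ n → ℚ.+-identityʳ (seq x n))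
          }
        ; inverse = (λ x → pointwise λ n → ℚ.+-inverseˡ (seq x n))
                  , (λ x → pointwise λ n → ℚ.+-inverseʳ (seq x n))
        ; ⁻¹-cong = -‿cong
        }
      ; comm = λ x y → pointwise λ n → ℚ.+-comm (seq x n) (seq y n)
      }
    }

  open AbelianGroup +-0-abelianGroup public using ()
    renaming ( assoc to +-assoc; comm to +-comm; identityˡ to +-identityˡ
             ; identityʳ to +-identityʳ; inverseˡ to +-inverseˡ
             ; inverseʳ to +-inverseʳ
             ; monoid to +-0-monoid)

  x+y-y≃x : ∀ m n → (m + n) - n ≃ m
  x+y-y≃x m n = ≃-trans (+-assoc m n (- n))
    (≃-trans (+-cong ≃-refl (+-inverseʳ n)) (+-identityʳ m))

  x-y+y≃x : ∀ m n → (m - n) + n ≃ m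
  x-y+y≃x m n = ≃-trans (+-assoc m (- n) n)
    (≃-trans (+-cong ≃-refl (+-inverseˡ n)) (+-identityʳ m))

open Real public using (ℝ; 0ℝ; _+_; _-_; -_; _≃_; _≤_)

record Category (o ℓ e : Level) : Set (lsuc (o ⊔ ℓ ⊔ e)) where
  infix 4 _≈_ _⇒_
  infixr 9 _∘_
  field
    Obj : Set o
    _⇒_ : Obj → Obj → Set ℓ
    _≈_ : ∀ {A B} → Rel (A ⇒ B) e
    id  : ∀ {A} → A ⇒ A
    _∘_ : ∀ {A B C} → B ⇒ C → A ⇒ B → A ⇒ C
    isEquivalence : ∀ {A B} → IsEquivalence (_≈_ {A} {B})
    ∘-resp-≈  : ∀ {A B C} {f h : B ⇒ C} {g i : A ⇒ B} → f ≈ h → g ≈ i → f ∘ g ≈ h ∘ i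
    assoc     : ∀ {A B C D} {f : A ⇒ B} {g : B ⇒ C} {h : C ⇒ D} → (h ∘ g) ∘ f ≈ h ∘ (g ∘ f)
    identityˡ : ∀ {A B} {f : A ⇒ B} → id ∘ f ≈ f
    identityʳ : ∀ {A B} {f : A ⇒ B} → f ∘ id ≈ f

  module Equiv {A B} = IsEquivalence (isEquivalence {A} {B})

  homSetoid : Obj → Obj → Setoid ℓ e
  homSetoid A B = record { isEquivalence = isEquivalence {A} {B} }

  module HomReasoning {A B} = SetoidReasoning (homSetoid A B)

  infixr 4 _⟩∘⟨_ refl⟩∘⟨_
  infixl 5 _⟩∘⟨refl

  _⟩∘⟨_ : ∀ {A B C} {f h : B ⇒ C} {g i : A ⇒ B} → f ≈ h → g ≈ i → f ∘ g ≈ h ∘ i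
  _⟩∘⟨_ = ∘-resp-≈

  refl⟩∘⟨_ : ∀ {A B C} {f : B ⇒ C} {g i : A ⇒ B} → g ≈ i → f ∘ g ≈ f ∘ i
  refl⟩∘⟨ p = ∘-resp-≈ Equiv.refl p

  _⟩∘⟨refl : ∀ {A B C} {f h : B ⇒ C} {g : A ⇒ B} → f ≈ h → f ∘ g ≈ h ∘ g
  p ⟩∘⟨refl = ∘-resp-≈ p Equiv.refl

  pullˡ : ∀ {A B C D} {f : A ⇒ B} {g : B ⇒ C} {h : C ⇒ D} {k : B ⇒ D} →
          h ∘ g ≈ k → h ∘ (g ∘ f) ≈ k ∘ f
  pullˡ p = Equiv.trans (Equiv.sym assoc) (p ⟩∘⟨refl)

  extendˡ : ∀ {A B C C' D} {f : A ⇒ B} {g : B ⇒ C} {h : C ⇒ D} {g' : B ⇒ C'} {h' : C' ⇒ D} →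
            h ∘ g ≈ h' ∘ g' → h ∘ (g ∘ f) ≈ h' ∘ (g' ∘ f)
  extendˡ p = Equiv.trans (pullˡ p) assoc

  infix 4 _≅_
  record _≅_ (A B : Obj) : Set (ℓ ⊔ e) where
    field
      from : A ⇒ B
      to   : B ⇒ A
      isoˡ : to ∘ from ≈ id
      isoʳ : from ∘ to ≈ id
  open _≅_ public

  private
    cancelInner : ∀ {A B C D} {h : C ⇒ D} {k : B ⇒ C} {k' : C ⇒ B} {g : A ⇒ C} →
                  k ∘ k' ≈ id → (h ∘ k) ∘ (k' ∘ g) ≈ h ∘ g
    cancelInner p = Equiv.trans assoc (refl⟩∘⟨ Equiv.trans (pullˡ p) identityˡ)

  ≅-refl : ∀ {A} → A ≅ A
  ≅-refl = record { from = id ; to = id ; isoˡ = identityˡ ; isoʳ = identityˡ }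

  ≅-sym : ∀ {A B} → A ≅ B → B ≅ A
  ≅-sym i = record { from = to i ; to = from i ; isoˡ = isoʳ i ; isoʳ = isoˡ i }

  infixr 5 _⟫_
  _⟫_ : ∀ {A B C} → A ≅ B → B ≅ C → A ≅ C
  i ⟫ j = record
    { from = from j ∘ from i
    ; to   = to i ∘ to j
    ; isoˡ = Equiv.trans (cancelInner (isoˡ j)) (isoˡ i)
    ; isoʳ = Equiv.trans (cancelInner (isoʳ i)) (isoʳ j)
    }

record MonoidalCategory (o ℓ e : Level) : Set (lsuc (o ⊔ ℓ ⊔ e)) where
  infixr 10 _⊗₀_ _⊗₁_
  field
    category : Category o ℓ e
  open Category category public
  field
    unit : Obj
    _⊗₀_ : Obj → Obj → Obj
    _⊗₁_ : ∀ {A B C D} → A ⇒ B → C ⇒ D → (A ⊗₀ C) ⇒ (B ⊗₀ D)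
    ⊗-resp-≈   : ∀ {A B C D} {f g : A ⇒ B} {h i : C ⇒ D} → f ≈ g → h ≈ i → f ⊗₁ h ≈ g ⊗₁ i
    ⊗-identity : ∀ {A B} → id {A} ⊗₁ id {B} ≈ id
    ⊗-homo     : ∀ {A B C A' B' C'} {f : A ⇒ B} {g : B ⇒ C} {f' : A' ⇒ B'} {g' : B' ⇒ C'} →
                 (g ∘ f) ⊗₁ (g' ∘ f') ≈ (g ⊗₁ g') ∘ (f ⊗₁ f')
    unitorˡ    : ∀ {A} → unit ⊗₀ A ≅ A
    unitorʳ    : ∀ {A} → A ⊗₀ unit ≅ A
    associator : ∀ {A B C} → (A ⊗₀ B) ⊗₀ C ≅ A ⊗₀ (B ⊗₀ C)

  λ⇒ : ∀ {A} → (unit ⊗₀ A) ⇒ A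
  λ⇒ = from unitorˡ

  ρ⇒ : ∀ {A} → (A ⊗₀ unit) ⇒ A
  ρ⇒ = from unitorʳ

  α⇒ : ∀ {A B C} → ((A ⊗₀ B) ⊗₀ C) ⇒ (A ⊗₀ (B ⊗₀ C))
  α⇒ = from associator

  field
    unitorˡ-natural    : ∀ {A B} {f : A ⇒ B} → λ⇒ ∘ (id ⊗₁ f) ≈ f ∘ λ⇒
    unitorʳ-natural    : ∀ {A B} {f : A ⇒ B} → ρ⇒ ∘ (f ⊗₁ id) ≈ f ∘ ρ⇒
    associator-natural : ∀ {A B C A' B' C'} {f : A ⇒ A'} {g : B ⇒ B'} {h : C ⇒ C'} →
                         α⇒ ∘ ((f ⊗₁ g) ⊗₁ h) ≈ (f ⊗₁ (g ⊗₁ h)) ∘ α⇒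
    triangle : ∀ {A B} → (id {A} ⊗₁ λ⇒ {B}) ∘ α⇒ ≈ ρ⇒ ⊗₁ id
    pentagon : ∀ {A B C D} →
               (id {A} ⊗₁ α⇒ {B} {C} {D}) ∘ (α⇒ ∘ (α⇒ ⊗₁ id)) ≈ α⇒ ∘ α⇒

  infixr 10 _⊗≅_
  _⊗≅_ : ∀ {A B C D} → A ≅ B → C ≅ D → A ⊗₀ C ≅ B ⊗₀ D
  i ⊗≅ j = record
    { from = from i ⊗₁ from j
    ; to   = to i ⊗₁ to j
    ; isoˡ = Equiv.trans (Equiv.sym ⊗-homo) (Equiv.trans (⊗-resp-≈ (isoˡ i) (isoˡ j)) ⊗-identity)
    ; isoʳ = Equiv.trans (Equiv.sym ⊗-homo) (Equiv.trans (⊗-resp-≈ (isoʳ i) (isoʳ j)) ⊗-identity)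
    }

record SymmetricMonoidalCategory (o ℓ e : Level) : Set (lsuc (o ⊔ ℓ ⊔ e)) where
  field
    monoidalCategory : MonoidalCategory o ℓ e
  open MonoidalCategory monoidalCategory public
  field
    σ         : ∀ {A B} → (A ⊗₀ B) ⇒ (B ⊗₀ A)
    σ-natural : ∀ {A B C D} {f : A ⇒ B} {g : C ⇒ D} → σ ∘ (f ⊗₁ g) ≈ (g ⊗₁ f) ∘ σ
    σ-involutive : ∀ {A B} → σ ∘ σ ≈ id {A ⊗₀ B}
    hexagon   : ∀ {A B C} →
                (id {B} ⊗₁ σ {A} {C}) ∘ (α⇒ ∘ (σ ⊗₁ id)) ≈ α⇒ ∘ (σ {A} {B ⊗₀ C} ∘ α⇒)

record MonoidalFunctor {o ℓ e o' ℓ' e'} (𝒞 : MonoidalCategory o ℓ e)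
                       (𝒟 : MonoidalCategory o' ℓ' e') :
                       Set (o ⊔ ℓ ⊔ e ⊔ o' ⊔ ℓ' ⊔ e') where
  private
    module C = MonoidalCategory 𝒞
    module D = MonoidalCategory 𝒟
  open MonoidalCategory 𝒟 using (from; _∘_; _≈_; _⊗₁_)
  field
    F₀ : C.Obj → D.Obj
    F₁ : ∀ {A B} → A C.⇒ B → F₀ A D.⇒ F₀ B
    F-resp-≈     : ∀ {A B} {f g : A C.⇒ B} → f C.≈ g → F₁ f ≈ F₁ g
    identity     : ∀ {A} → F₁ (C.id {A}) ≈ D.id
    homomorphism : ∀ {A B C} {f : A C.⇒ B} {g : B C.⇒ C} → F₁ (g C.∘ f) ≈ F₁ g ∘ F₁ f
    ε-iso : D.unit D.≅ F₀ C.unit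
    μ-iso : ∀ {A B} → F₀ A D.⊗₀ F₀ B D.≅ F₀ (A C.⊗₀ B)

  ε⇒ : D.unit D.⇒ F₀ C.unit
  ε⇒ = from ε-iso

  μ⇒ : ∀ {A B} → (F₀ A D.⊗₀ F₀ B) D.⇒ F₀ (A C.⊗₀ B)
  μ⇒ = from μ-iso

  field
    μ-natural     : ∀ {A B A' B'} {f : A C.⇒ A'} {g : B C.⇒ B'} →
                    μ⇒ ∘ (F₁ f ⊗₁ F₁ g) ≈ F₁ (f C.⊗₁ g) ∘ μ⇒
    associativity : ∀ {A B C} → F₁ (C.α⇒ {A} {B} {C}) ∘ (μ⇒ ∘ (μ⇒ ⊗₁ D.id))
                              ≈ μ⇒ ∘ ((D.id ⊗₁ μ⇒) ∘ D.α⇒)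
    unitalityˡ    : ∀ {A} → F₁ (C.λ⇒ {A}) ∘ (μ⇒ ∘ (ε⇒ ⊗₁ D.id)) ≈ D.λ⇒
    unitalityʳ    : ∀ {A} → F₁ (C.ρ⇒ {A}) ∘ (μ⇒ ∘ (D.id ⊗₁ ε⇒)) ≈ D.ρ⇒

  F-≅ : ∀ {A B} → A C.≅ B → F₀ A D.≅ F₀ B
  F-≅ i = record
    { from = F₁ (C.from i)
    ; to   = F₁ (C.to i)
    ; isoˡ = D.Equiv.trans (D.Equiv.sym homomorphism) (D.Equiv.trans (F-resp-≈ (C.isoˡ i)) identity)
    ; isoʳ = D.Equiv.trans (D.Equiv.sym homomorphism) (D.Equiv.trans (F-resp-≈ (C.isoʳ i)) identity)
    }

record SymmetricMonoidalFunctor {o ℓ e o' ℓ' e'} (𝒞 : SymmetricMonoidalCategory o ℓ e)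
                                (𝒟 : SymmetricMonoidalCategory o' ℓ' e') :
                                Set (o ⊔ ℓ ⊔ e ⊔ o' ⊔ ℓ' ⊔ e') where
  private
    module C = SymmetricMonoidalCategory 𝒞
    module D = SymmetricMonoidalCategory 𝒟
  field
    monoidalFunctor : MonoidalFunctor C.monoidalCategory D.monoidalCategory
  open MonoidalFunctor monoidalFunctor public
  field
    braided : ∀ {A B} → F₁ (C.σ {A} {B}) D.∘ μ⇒ D.≈ μ⇒ D.∘ D.σ

record MonoidalTransformation {o ℓ e o' ℓ' e'} {𝒞 : MonoidalCategory o ℓ e}
                              {𝒟 : MonoidalCategory o' ℓ' e'} (F G : MonoidalFunctor 𝒞 𝒟) :
                              Set (o ⊔ ℓ ⊔ e ⊔ o' ⊔ ℓ' ⊔ e') where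
  private
    module C = MonoidalCategory 𝒞
    module D = MonoidalCategory 𝒟
    module F = MonoidalFunctor F
    module G = MonoidalFunctor G
  field
    η       : ∀ A → F.F₀ A D.⇒ G.F₀ A
    natural : ∀ {A B} {f : A C.⇒ B} → η B D.∘ F.F₁ f D.≈ G.F₁ f D.∘ η A
    η-ε     : η C.unit D.∘ F.ε⇒ D.≈ G.ε⇒
    η-μ     : ∀ {A B} → η (A C.⊗₀ B) D.∘ F.μ⇒ D.≈ G.μ⇒ D.∘ (η A D.⊗₁ η B)

-- The discrete category on the carrier, monoidal under _∙_.  Morphisms x ⇒ y are
-- proofs of x ≈ y, any two of which are equal; the laws hold because every
-- equation between morphisms is the unit type, and are left to unification.

Discrete : ∀ {c ℓ} → Monoid c ℓ → MonoidalCategory c ℓ 0ℓ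
Discrete M = record
  { category = record
    { Obj = Carrier ; _⇒_ = M._≈_ ; _≈_ = λ _ _ → ⊤ ; id = M.refl ; _∘_ = λ q p → M.trans p q }
  ; unit = M.ε
  ; _⊗₀_ = M._∙_
  ; _⊗₁_ = M.∙-cong
  ; unitorˡ = record { from = M.identityˡ _ ; to = M.sym (M.identityˡ _) }
  ; unitorʳ = record { from = M.identityʳ _ ; to = M.sym (M.identityʳ _) }
  ; associator = record { from = M.assoc _ _ _ ; to = M.sym (M.assoc _ _ _) }
  }
  where
  module M = Monoid M
  open M using (Carrier)

module _ {o ℓ e} (𝒞 : SymmetricMonoidalCategory o ℓ e) where

  open SymmetricMonoidalCategory 𝒞
  open HomReasoning

  private
    SMF : Set (o ⊔ ℓ ⊔ e)
    SMF = SymmetricMonoidalFunctor 𝒞 𝒞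

    module SMF = SymmetricMonoidalFunctor

  infix 4 _⟹_
  _⟹_ : SMF → SMF → Set (o ⊔ ℓ ⊔ e)
  F ⟹ G = MonoidalTransformation (SMF.monoidalFunctor F) (SMF.monoidalFunctor G)

  private
    module T {F G : SMF} (t : F ⟹ G) = MonoidalTransformation t

    ⊗-splitˡ : ∀ {A B C D} {f : B ⇒ C} {g : A ⇒ B} → (f ∘ g) ⊗₁ id {D} ≈ (f ⊗₁ id) ∘ (g ⊗₁ id)
    ⊗-splitˡ = Equiv.trans (⊗-resp-≈ Equiv.refl (Equiv.sym identityˡ)) ⊗-homo

    ⊗-splitʳ : ∀ {A B C D} {f : B ⇒ C} {g : A ⇒ B} → id {D} ⊗₁ (f ∘ g) ≈ (id ⊗₁ f) ∘ (id ⊗₁ g)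
    ⊗-splitʳ = Equiv.trans (⊗-resp-≈ (Equiv.sym identityˡ) Equiv.refl) ⊗-homo

    module Lemmas (F : SMF) where
      open SMF F

      μ-stepˡ : ∀ {A B C D} {f : B ⇒ C} {g : A ⇒ F₀ B} →
                μ⇒ ∘ ((F₁ f ∘ g) ⊗₁ id {F₀ D}) ≈ F₁ (f ⊗₁ id) ∘ (μ⇒ ∘ (g ⊗₁ id))
      μ-stepˡ {f = f} {g} = begin
        μ⇒ ∘ ((F₁ f ∘ g) ⊗₁ id)              ≈⟨ refl⟩∘⟨ ⊗-splitˡ ⟩
        μ⇒ ∘ ((F₁ f ⊗₁ id) ∘ (g ⊗₁ id))      ≈⟨ refl⟩∘⟨ (⊗-resp-≈ Equiv.refl (Equiv.sym identity) ⟩∘⟨refl) ⟩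
        μ⇒ ∘ ((F₁ f ⊗₁ F₁ id) ∘ (g ⊗₁ id))   ≈⟨ extendˡ μ-natural ⟩
        F₁ (f ⊗₁ id) ∘ (μ⇒ ∘ (g ⊗₁ id))      ∎

      μ-stepʳ : ∀ {A B C D} {f : B ⇒ C} {g : A ⇒ F₀ B} →
                μ⇒ ∘ (id {F₀ D} ⊗₁ (F₁ f ∘ g)) ≈ F₁ (id ⊗₁ f) ∘ (μ⇒ ∘ (id ⊗₁ g))
      μ-stepʳ {f = f} {g} = begin
        μ⇒ ∘ (id ⊗₁ (F₁ f ∘ g))              ≈⟨ refl⟩∘⟨ ⊗-splitʳ ⟩
        μ⇒ ∘ ((id ⊗₁ F₁ f) ∘ (id ⊗₁ g))      ≈⟨ refl⟩∘⟨ (⊗-resp-≈ (Equiv.sym identity) Equiv.refl ⟩∘⟨refl) ⟩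
        μ⇒ ∘ ((F₁ id ⊗₁ F₁ f) ∘ (id ⊗₁ g))   ≈⟨ extendˡ μ-natural ⟩
        F₁ (id ⊗₁ f) ∘ (μ⇒ ∘ (id ⊗₁ g))      ∎

      F-∘₃ : ∀ {A B C D} {f : A ⇒ B} {g : B ⇒ C} {h : C ⇒ D} →
             F₁ (h ∘ (g ∘ f)) ≈ F₁ h ∘ (F₁ g ∘ F₁ f)
      F-∘₃ = Equiv.trans homomorphism (refl⟩∘⟨ homomorphism)

  idF : SMF
  idF = record
    { monoidalFunctor = record
      { F₀ = λ A → A
      ; F₁ = λ f → f
      ; F-resp-≈ = λ p → p
      ; identity = Equiv.refl
      ; homomorphism = Equiv.refl
      ; ε-iso = ≅-refl
      ; μ-iso = ≅-refl
      ; μ-natural = Equiv.trans identityˡ (Equiv.sym identityʳ)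
      ; associativity = begin
          α⇒ ∘ (id ∘ (id ⊗₁ id))    ≈⟨ refl⟩∘⟨ Equiv.trans identityˡ ⊗-identity ⟩
          α⇒ ∘ id                   ≈⟨ identityʳ ⟩
          α⇒                        ≈⟨ identityˡ ⟨
          id ∘ α⇒                   ≈⟨ ⊗-identity ⟩∘⟨refl ⟨
          (id ⊗₁ id) ∘ α⇒           ≈⟨ identityˡ ⟨
          id ∘ ((id ⊗₁ id) ∘ α⇒)    ∎
      ; unitalityˡ = Equiv.trans (refl⟩∘⟨ Equiv.trans identityˡ ⊗-identity) identityʳ
      ; unitalityʳ = Equiv.trans (refl⟩∘⟨ Equiv.trans identityˡ ⊗-identity) identityʳ
      }
    ; braided = Equiv.trans identityʳ (Equiv.sym identityˡ)
    }

  infixr 9 _∘F_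
  _∘F_ : SMF → SMF → SMF
  F ∘F G = record
    { monoidalFunctor = record
      { F₀ = λ A → F.F₀ (G.F₀ A)
      ; F₁ = λ f → F.F₁ (G.F₁ f)
      ; F-resp-≈ = λ p → F.F-resp-≈ (G.F-resp-≈ p)
      ; identity = Equiv.trans (F.F-resp-≈ G.identity) F.identity
      ; homomorphism = Equiv.trans (F.F-resp-≈ G.homomorphism) F.homomorphism
      ; ε-iso = F.ε-iso ⟫ F.F-≅ G.ε-iso
      ; μ-iso = F.μ-iso ⟫ F.F-≅ G.μ-iso
      ; μ-natural = λ {_} {_} {_} {_} {f} {g} → begin
          (F.F₁ G.μ⇒ ∘ F.μ⇒) ∘ (F.F₁ (G.F₁ f) ⊗₁ F.F₁ (G.F₁ g))  ≈⟨ assoc ⟩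
          F.F₁ G.μ⇒ ∘ (F.μ⇒ ∘ (F.F₁ (G.F₁ f) ⊗₁ F.F₁ (G.F₁ g)))  ≈⟨ refl⟩∘⟨ F.μ-natural ⟩
          F.F₁ G.μ⇒ ∘ (F.F₁ (G.F₁ f ⊗₁ G.F₁ g) ∘ F.μ⇒)           ≈⟨ extendˡ (square G.μ-natural) ⟩
          F.F₁ (G.F₁ (f ⊗₁ g)) ∘ (F.F₁ G.μ⇒ ∘ F.μ⇒)              ∎
      ; associativity = begin
          FG α⇒ ∘ ((F.F₁ G.μ⇒ ∘ F.μ⇒) ∘ ((F.F₁ G.μ⇒ ∘ F.μ⇒) ⊗₁ id))
            ≈⟨ refl⟩∘⟨ assoc ⟩
          FG α⇒ ∘ (F.F₁ G.μ⇒ ∘ (F.μ⇒ ∘ ((F.F₁ G.μ⇒ ∘ F.μ⇒) ⊗₁ id)))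
            ≈⟨ refl⟩∘⟨ refl⟩∘⟨ LF.μ-stepˡ ⟩
          FG α⇒ ∘ (F.F₁ G.μ⇒ ∘ (F.F₁ (G.μ⇒ ⊗₁ id) ∘ (F.μ⇒ ∘ (F.μ⇒ ⊗₁ id))))
            ≈⟨ rotate G.associativity ⟩
          F.F₁ G.μ⇒ ∘ (F.F₁ (id ⊗₁ G.μ⇒) ∘ (F.F₁ α⇒ ∘ (F.μ⇒ ∘ (F.μ⇒ ⊗₁ id))))
            ≈⟨ refl⟩∘⟨ refl⟩∘⟨ F.associativity ⟩
          F.F₁ G.μ⇒ ∘ (F.F₁ (id ⊗₁ G.μ⇒) ∘ (F.μ⇒ ∘ ((id ⊗₁ F.μ⇒) ∘ α⇒)))
            ≈⟨ refl⟩∘⟨ Equiv.trans (refl⟩∘⟨ Equiv.sym assoc) (pullˡ (Equiv.sym LF.μ-stepʳ)) ⟩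
          F.F₁ G.μ⇒ ∘ ((F.μ⇒ ∘ (id ⊗₁ (F.F₁ G.μ⇒ ∘ F.μ⇒))) ∘ α⇒)
            ≈⟨ refl⟩∘⟨ assoc ⟩
          F.F₁ G.μ⇒ ∘ (F.μ⇒ ∘ ((id ⊗₁ (F.F₁ G.μ⇒ ∘ F.μ⇒)) ∘ α⇒))
            ≈⟨ assoc ⟨
          (F.F₁ G.μ⇒ ∘ F.μ⇒) ∘ ((id ⊗₁ (F.F₁ G.μ⇒ ∘ F.μ⇒)) ∘ α⇒) ∎
      ; unitalityˡ = begin
          FG λ⇒ ∘ ((F.F₁ G.μ⇒ ∘ F.μ⇒) ∘ ((F.F₁ G.ε⇒ ∘ F.ε⇒) ⊗₁ id))
            ≈⟨ refl⟩∘⟨ assoc ⟩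
          FG λ⇒ ∘ (F.F₁ G.μ⇒ ∘ (F.μ⇒ ∘ ((F.F₁ G.ε⇒ ∘ F.ε⇒) ⊗₁ id)))
            ≈⟨ refl⟩∘⟨ refl⟩∘⟨ LF.μ-stepˡ ⟩
          FG λ⇒ ∘ (F.F₁ G.μ⇒ ∘ (F.F₁ (G.ε⇒ ⊗₁ id) ∘ (F.μ⇒ ∘ (F.ε⇒ ⊗₁ id))))
            ≈⟨ collapse G.unitalityˡ ⟩
          F.F₁ λ⇒ ∘ (F.μ⇒ ∘ (F.ε⇒ ⊗₁ id))
            ≈⟨ F.unitalityˡ ⟩
          λ⇒ ∎
      ; unitalityʳ = begin
          FG ρ⇒ ∘ ((F.F₁ G.μ⇒ ∘ F.μ⇒) ∘ (id ⊗₁ (F.F₁ G.ε⇒ ∘ F.ε⇒)))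
            ≈⟨ refl⟩∘⟨ assoc ⟩
          FG ρ⇒ ∘ (F.F₁ G.μ⇒ ∘ (F.μ⇒ ∘ (id ⊗₁ (F.F₁ G.ε⇒ ∘ F.ε⇒))))
            ≈⟨ refl⟩∘⟨ refl⟩∘⟨ LF.μ-stepʳ ⟩
          FG ρ⇒ ∘ (F.F₁ G.μ⇒ ∘ (F.F₁ (id ⊗₁ G.ε⇒) ∘ (F.μ⇒ ∘ (id ⊗₁ F.ε⇒))))
            ≈⟨ collapse G.unitalityʳ ⟩
          F.F₁ ρ⇒ ∘ (F.μ⇒ ∘ (id ⊗₁ F.ε⇒))
            ≈⟨ F.unitalityʳ ⟩
          ρ⇒ ∎
      }
    ; braided = begin
        FG σ ∘ (F.F₁ G.μ⇒ ∘ F.μ⇒)     ≈⟨ extendˡ (square G.braided) ⟩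
        F.F₁ G.μ⇒ ∘ (F.F₁ σ ∘ F.μ⇒)   ≈⟨ refl⟩∘⟨ F.braided ⟩
        F.F₁ G.μ⇒ ∘ (F.μ⇒ ∘ σ)        ≈⟨ assoc ⟨
        (F.F₁ G.μ⇒ ∘ F.μ⇒) ∘ σ        ∎
    }
    where
    module F = SMF F
    module G = SMF G
    module LF = Lemmas F

    FG : ∀ {A B} → A ⇒ B → F.F₀ (G.F₀ A) ⇒ F.F₀ (G.F₀ B)
    FG f = F.F₁ (G.F₁ f)

    square : ∀ {A B B' D} {f : A ⇒ B} {g : B ⇒ D} {f' : A ⇒ B'} {g' : B' ⇒ D} →
             g ∘ f ≈ g' ∘ f' → F.F₁ g ∘ F.F₁ f ≈ F.F₁ g' ∘ F.F₁ f'
    square p = Equiv.trans (Equiv.sym F.homomorphism)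
                           (Equiv.trans (F.F-resp-≈ p) F.homomorphism)

    assoc₃ : ∀ {A B C D E} {k : A ⇒ B} {f : B ⇒ C} {g : C ⇒ D} {h : D ⇒ E} →
             (h ∘ (g ∘ f)) ∘ k ≈ h ∘ (g ∘ (f ∘ k))
    assoc₃ = Equiv.trans assoc (refl⟩∘⟨ assoc)

    rotate : ∀ {Z A B C D B' C'} {f : A ⇒ B} {g : B ⇒ C} {h : C ⇒ D}
             {f' : A ⇒ B'} {g' : B' ⇒ C'} {h' : C' ⇒ D} {k : Z ⇒ F.F₀ A} →
             h ∘ (g ∘ f) ≈ h' ∘ (g' ∘ f') →
             F.F₁ h ∘ (F.F₁ g ∘ (F.F₁ f ∘ k)) ≈ F.F₁ h' ∘ (F.F₁ g' ∘ (F.F₁ f' ∘ k))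
    rotate {f = f} {g} {h} {f'} {g'} {h'} {k} p = begin
      F.F₁ h ∘ (F.F₁ g ∘ (F.F₁ f ∘ k))     ≈⟨ assoc₃ ⟨
      (F.F₁ h ∘ (F.F₁ g ∘ F.F₁ f)) ∘ k     ≈⟨ LF.F-∘₃ ⟩∘⟨refl ⟨
      F.F₁ (h ∘ (g ∘ f)) ∘ k               ≈⟨ F.F-resp-≈ p ⟩∘⟨refl ⟩
      F.F₁ (h' ∘ (g' ∘ f')) ∘ k            ≈⟨ LF.F-∘₃ ⟩∘⟨refl ⟩
      (F.F₁ h' ∘ (F.F₁ g' ∘ F.F₁ f')) ∘ k  ≈⟨ assoc₃ ⟩
      F.F₁ h' ∘ (F.F₁ g' ∘ (F.F₁ f' ∘ k))  ∎

    collapse : ∀ {Z A B C D} {f : A ⇒ B} {g : B ⇒ C} {h : C ⇒ D} {l : A ⇒ D} {k : Z ⇒ F.F₀ A} →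
               h ∘ (g ∘ f) ≈ l → F.F₁ h ∘ (F.F₁ g ∘ (F.F₁ f ∘ k)) ≈ F.F₁ l ∘ k
    collapse {f = f} {g} {h} {l} {k} p = begin
      F.F₁ h ∘ (F.F₁ g ∘ (F.F₁ f ∘ k))     ≈⟨ assoc₃ ⟨
      (F.F₁ h ∘ (F.F₁ g ∘ F.F₁ f)) ∘ k     ≈⟨ LF.F-∘₃ ⟩∘⟨refl ⟨
      F.F₁ (h ∘ (g ∘ f)) ∘ k               ≈⟨ F.F-resp-≈ p ⟩∘⟨refl ⟩
      F.F₁ l ∘ k                           ∎

  idT : ∀ {F} → F ⟹ F
  idT {F} = record
    { η = λ _ → id
    ; natural = Equiv.trans identityˡ (Equiv.sym identityʳ)
    ; η-ε = identityˡ
    ; η-μ = Equiv.trans identityˡ (Equiv.sym (Equiv.trans (refl⟩∘⟨ ⊗-identity) identityʳ))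
    }

  infixr 9 _∘T_
  _∘T_ : ∀ {F G H} → G ⟹ H → F ⟹ G → F ⟹ H
  _∘T_ {F} {G} {H} s t = record
    { η = λ A → S.η A ∘ R.η A
    ; natural = λ {A} {B} {f} → begin
        (S.η B ∘ R.η B) ∘ F.F₁ f   ≈⟨ assoc ⟩
        S.η B ∘ (R.η B ∘ F.F₁ f)   ≈⟨ refl⟩∘⟨ R.natural ⟩
        S.η B ∘ (G.F₁ f ∘ R.η A)   ≈⟨ extendˡ S.natural ⟩
        H.F₁ f ∘ (S.η A ∘ R.η A)   ∎
    ; η-ε = Equiv.trans assoc (Equiv.trans (refl⟩∘⟨ R.η-ε) S.η-ε)
    ; η-μ = λ {A} {B} → begin
        (S.η _ ∘ R.η _) ∘ F.μ⇒                       ≈⟨ assoc ⟩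
        S.η _ ∘ (R.η _ ∘ F.μ⇒)                       ≈⟨ refl⟩∘⟨ R.η-μ ⟩
        S.η _ ∘ (G.μ⇒ ∘ (R.η A ⊗₁ R.η B))            ≈⟨ extendˡ S.η-μ ⟩
        H.μ⇒ ∘ ((S.η A ⊗₁ S.η B) ∘ (R.η A ⊗₁ R.η B)) ≈⟨ refl⟩∘⟨ ⊗-homo ⟨
        H.μ⇒ ∘ ((S.η A ∘ R.η A) ⊗₁ (S.η B ∘ R.η B))  ∎
    }
    where
    module F = SMF F
    module G = SMF G
    module H = SMF H
    module R = T {F} {G} t
    module S = T {G} {H} s

  infixr 10 _∘ₕ_
  _∘ₕ_ : ∀ {F F' G G'} → F ⟹ F' → G ⟹ G' → (F ∘F G) ⟹ (F' ∘F G')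
  _∘ₕ_ {F} {F'} {G} {G'} s t = record
    { η = λ A → F'.F₁ (R.η A) ∘ S.η (G.F₀ A)
    ; natural = λ {A} {B} {f} → begin
        (F'.F₁ (R.η B) ∘ S.η _) ∘ F.F₁ (G.F₁ f)    ≈⟨ assoc ⟩
        F'.F₁ (R.η B) ∘ (S.η _ ∘ F.F₁ (G.F₁ f))    ≈⟨ refl⟩∘⟨ S.natural ⟩
        F'.F₁ (R.η B) ∘ (F'.F₁ (G.F₁ f) ∘ S.η _)   ≈⟨ extendˡ (square R.natural) ⟩
        F'.F₁ (G'.F₁ f) ∘ (F'.F₁ (R.η A) ∘ S.η _)  ∎
    ; η-ε = begin
        (F'.F₁ (R.η _) ∘ S.η _) ∘ (F.F₁ G.ε⇒ ∘ F.ε⇒)    ≈⟨ assoc ⟩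
        F'.F₁ (R.η _) ∘ (S.η _ ∘ (F.F₁ G.ε⇒ ∘ F.ε⇒))    ≈⟨ refl⟩∘⟨ extendˡ S.natural ⟩
        F'.F₁ (R.η _) ∘ (F'.F₁ G.ε⇒ ∘ (S.η _ ∘ F.ε⇒))   ≈⟨ pullˡ (Equiv.trans (Equiv.sym F'.homomorphism) (F'.F-resp-≈ R.η-ε)) ⟩
        F'.F₁ G'.ε⇒ ∘ (S.η _ ∘ F.ε⇒)                    ≈⟨ refl⟩∘⟨ S.η-ε ⟩
        F'.F₁ G'.ε⇒ ∘ F'.ε⇒                             ∎
    ; η-μ = λ {A} {B} → begin
        (F'.F₁ (R.η _) ∘ S.η _) ∘ (F.F₁ G.μ⇒ ∘ F.μ⇒)
          ≈⟨ assoc ⟩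
        F'.F₁ (R.η _) ∘ (S.η _ ∘ (F.F₁ G.μ⇒ ∘ F.μ⇒))
          ≈⟨ refl⟩∘⟨ extendˡ S.natural ⟩
        F'.F₁ (R.η _) ∘ (F'.F₁ G.μ⇒ ∘ (S.η _ ∘ F.μ⇒))
          ≈⟨ extendˡ (square R.η-μ) ⟩
        F'.F₁ G'.μ⇒ ∘ (F'.F₁ (R.η A ⊗₁ R.η B) ∘ (S.η _ ∘ F.μ⇒))
          ≈⟨ refl⟩∘⟨ refl⟩∘⟨ S.η-μ ⟩
        F'.F₁ G'.μ⇒ ∘ (F'.F₁ (R.η A ⊗₁ R.η B) ∘ (F'.μ⇒ ∘ (S.η _ ⊗₁ S.η _)))
          ≈⟨ refl⟩∘⟨ extendˡ (Equiv.sym F'.μ-natural) ⟩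
        F'.F₁ G'.μ⇒ ∘ (F'.μ⇒ ∘ ((F'.F₁ (R.η A) ⊗₁ F'.F₁ (R.η B)) ∘ (S.η _ ⊗₁ S.η _)))
          ≈⟨ refl⟩∘⟨ refl⟩∘⟨ ⊗-homo ⟨
        F'.F₁ G'.μ⇒ ∘ (F'.μ⇒ ∘ ((F'.F₁ (R.η A) ∘ S.η _) ⊗₁ (F'.F₁ (R.η B) ∘ S.η _)))
          ≈⟨ assoc ⟨
        (F'.F₁ G'.μ⇒ ∘ F'.μ⇒) ∘ ((F'.F₁ (R.η A) ∘ S.η _) ⊗₁ (F'.F₁ (R.η B) ∘ S.η _)) ∎
    }
    where
    module F = SMF F
    module F' = SMF F'
    module G = SMF G
    module G' = SMF G'
    module S = T {F} {F'} s
    module R = T {G} {G'} t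

    square : ∀ {A B B' D} {f : A ⇒ B} {g : B ⇒ D} {f' : A ⇒ B'} {g' : B' ⇒ D} →
             g ∘ f ≈ g' ∘ f' → F'.F₁ g ∘ F'.F₁ f ≈ F'.F₁ g' ∘ F'.F₁ f'
    square p = Equiv.trans (Equiv.sym F'.homomorphism)
                           (Equiv.trans (F'.F-resp-≈ p) F'.homomorphism)

  endoCategory : Category (o ⊔ ℓ ⊔ e) (o ⊔ ℓ ⊔ e) (o ⊔ e)
  endoCategory = record
    { Obj = SMF
    ; _⇒_ = _⟹_
    ; _≈_ = λ {F} {G} s t → ∀ A → T.η {F} {G} s A ≈ T.η {F} {G} t A
    ; id = λ {F} → idT {F}
    ; _∘_ = λ {F} {G} {H} s t → _∘T_ {F} {G} {H} s t
    ; isEquivalence = record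
      { refl = λ _ → Equiv.refl ; sym = λ p A → Equiv.sym (p A) ; trans = λ p q A → Equiv.trans (p A) (q A) }
    ; ∘-resp-≈ = λ p q A → p A ⟩∘⟨ q A
    ; assoc = λ _ → assoc
    ; identityˡ = λ _ → identityˡ
    ; identityʳ = λ _ → identityʳ
    }

  private
    pointwiseIso : ∀ (F G : SMF) (t : F ⟹ G) (ζ : ∀ A → SMF.F₀ G A ⇒ SMF.F₀ F A) →
                  (∀ A → ζ A ∘ T.η {F} {G} t A ≈ id) → (∀ A → T.η {F} {G} t A ∘ ζ A ≈ id) →
                  Category._≅_ endoCategory F G
    pointwiseIso F G t ζ ζη ηζ = record
      { from = t
      ; to = record
        { η = ζ
        ; natural = λ {A} {B} {f} → begin
            ζ B ∘ G.F₁ f                      ≈⟨ refl⟩∘⟨ Equiv.trans (refl⟩∘⟨ ηζ A) identityʳ ⟨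
            ζ B ∘ (G.F₁ f ∘ (R.η A ∘ ζ A))    ≈⟨ refl⟩∘⟨ extendˡ (Equiv.sym R.natural) ⟩
            ζ B ∘ (R.η B ∘ (F.F₁ f ∘ ζ A))    ≈⟨ Equiv.trans (pullˡ (ζη B)) identityˡ ⟩
            F.F₁ f ∘ ζ A                      ∎
        ; η-ε = Equiv.trans (refl⟩∘⟨ Equiv.sym R.η-ε) (Equiv.trans (pullˡ (ζη _)) identityˡ)
        ; η-μ = λ {A} {B} → begin
            ζ _ ∘ G.μ⇒                                              ≈⟨ refl⟩∘⟨ identityʳ ⟨
            ζ _ ∘ (G.μ⇒ ∘ id)                                       ≈⟨ refl⟩∘⟨ refl⟩∘⟨ Equiv.trans (Equiv.sym ⊗-homo) (Equiv.trans (⊗-resp-≈ (ηζ A) (ηζ B)) ⊗-identity) ⟨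
            ζ _ ∘ (G.μ⇒ ∘ ((R.η A ⊗₁ R.η B) ∘ (ζ A ⊗₁ ζ B)))         ≈⟨ refl⟩∘⟨ extendˡ (Equiv.sym R.η-μ) ⟩
            ζ _ ∘ (R.η _ ∘ (F.μ⇒ ∘ (ζ A ⊗₁ ζ B)))                   ≈⟨ Equiv.trans (pullˡ (ζη _)) identityˡ ⟩
            F.μ⇒ ∘ (ζ A ⊗₁ ζ B)                                     ∎
        }
      ; isoˡ = ζη
      ; isoʳ = ηζ
      }
      where
      module F = SMF F
      module G = SMF G
      module R = T {F} {G} t

    id-commutes : ∀ {A B} {f : A ⇒ B} → id ∘ f ≈ f ∘ id
    id-commutes = Equiv.trans identityˡ (Equiv.sym identityʳ)

    drop-⊗id : ∀ {A B C} {f : (A ⊗₀ B) ⇒ C} → f ∘ (id ⊗₁ id) ≈ f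
    drop-⊗id = Equiv.trans (refl⟩∘⟨ ⊗-identity) identityʳ

  -- symmetric monoidal endofunctors and monoidal natural transformations, monoidal
  -- under composition of functors
  SymMonEnd : MonoidalCategory (o ⊔ ℓ ⊔ e) (o ⊔ ℓ ⊔ e) (o ⊔ e)
  SymMonEnd = record
    { category = endoCategory
    ; unit = idF
    ; _⊗₀_ = _∘F_
    ; _⊗₁_ = λ {F} {F'} {G} {G'} s t → _∘ₕ_ {F} {F'} {G} {G'} s t
    ; ⊗-resp-≈ = λ {_} {F'} p q A → SMF.F-resp-≈ F' (q A) ⟩∘⟨ p _
    ; ⊗-identity = λ {F} A → Equiv.trans identityʳ (SMF.identity F)
    ; ⊗-homo = λ {F} {F'} {F''} {G} {G'} {G''} {s} {s'} {t} {t'} A →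
        Equiv.trans (SMF.homomorphism F'' ⟩∘⟨refl)
          (Equiv.trans assoc
            (Equiv.trans (refl⟩∘⟨ extendˡ (Equiv.sym (T.natural {F'} {F''} s'))) (Equiv.sym assoc)))
    ; unitorˡ = λ {F} → pointwiseIso (idF ∘F F) F
        (record { η = λ _ → id ; natural = id-commutes
                ; η-ε = Equiv.trans identityˡ identityʳ
                ; η-μ = Equiv.trans identityˡ (Equiv.trans identityʳ (Equiv.sym drop-⊗id)) })
        (λ _ → id) (λ _ → identityˡ) (λ _ → identityˡ)
    ; unitorʳ = λ {F} → pointwiseIso (F ∘F idF) F
        (record { η = λ _ → id ; natural = id-commutes
                ; η-ε = Equiv.trans identityˡ (Equiv.trans (SMF.identity F ⟩∘⟨refl) identityˡ)
                ; η-μ = Equiv.trans identityˡ (Equiv.trans (Equiv.trans (SMF.identity F ⟩∘⟨refl) identityˡ) (Equiv.sym drop-⊗id)) })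
        (λ _ → id) (λ _ → identityˡ) (λ _ → identityˡ)
    ; associator = λ {F} {G} {H} → pointwiseIso ((F ∘F G) ∘F H) (F ∘F (G ∘F H))
        (record { η = λ _ → id ; natural = id-commutes
                ; η-ε = Equiv.trans identityˡ (reassociate F)
                ; η-μ = Equiv.trans identityˡ (Equiv.trans (reassociate F) (Equiv.sym drop-⊗id)) })
        (λ _ → id) (λ _ → identityˡ) (λ _ → identityˡ)
    ; unitorˡ-natural = λ _ → identityˡ
    ; unitorʳ-natural = λ {F} {G} A → Equiv.trans identityˡ
        (Equiv.trans (SMF.identity G ⟩∘⟨refl) (Equiv.trans identityˡ (Equiv.sym identityʳ)))
    ; associator-natural = λ {_} {_} {_} {F} {G} {H} A → Equiv.trans identityˡ
        (Equiv.trans (reassociate F) (Equiv.sym identityʳ))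
    ; triangle = λ {F} A → Equiv.trans identityʳ (Equiv.trans identityʳ (Equiv.sym identityʳ))
    ; pentagon = λ {F} {G} {H} A → Equiv.trans identityʳ (SMF.identity F) ⟩∘⟨
        Equiv.trans identityˡ (Equiv.trans identityʳ (SMF.identity (F ∘F (G ∘F H))))
    }
    where
    reassociate : ∀ (F : SMF) {A B C D} {f : A ⇒ SMF.F₀ F B} {g : B ⇒ C} {h : C ⇒ D} →
                  SMF.F₁ F h ∘ (SMF.F₁ F g ∘ f) ≈ SMF.F₁ F (h ∘ g) ∘ f
    reassociate F = Equiv.trans (Equiv.sym assoc) (Equiv.sym (SMF.homomorphism F) ⟩∘⟨refl)

record Signature : Set₁ where
  field
    Qubit Gate      : Set
    qubits          : Gate → List Qubit
    qubits-distinct : ∀ G → Unique (qubits G)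
    duration        : Gate → ℝ
    duration≥0      : ∀ G → 0ℝ ≤ duration G

module Calculus (Sig : Signature) where

  open Signature Sig

  infixr 10 _⊗_
  data Ty : Set where
    one : Ty
    ‵_  : Qubit → Ty
    _⊗_ : Ty → Ty → Ty
    □   : ℝ → Ty → Ty

  -- q₁ ⊗ ⋯ ⊗ qₙ, bracketed to the right, with no trailing unit
  ⨂ : List Qubit → Ty
  ⨂ []            = one
  ⨂ (q ∷ [])      = ‵ q
  ⨂ (q ∷ r ∷ qs) = ‵ q ⊗ ⨂ (r ∷ qs)

  Var : Set
  Var = ℕ

  infix 9 _⦂[_]_
  record Decl : Set where
    constructor _⦂[_]_
    field
      name  : Var
      grade : ℝ
      type  : Ty

  -- Names in a context need not be distinct: nothing below depends on freshness.
  Ctx : Set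
  Ctx = List Decl

  delayDecl : ℝ → Decl → Decl
  delayDecl d (x ⦂[ e ] A) = x ⦂[ d + e ] A

  infixr 6 _+ᶜ_
  _+ᶜ_ : ℝ → Ctx → Ctx
  d +ᶜ Γ = map (delayDecl d) Γ

  infix 4 _≈ᵗ_ _≈ᵈ_ _≈ᶜ_
  data _≈ᵗ_ : Ty → Ty → Set where
    one : one ≈ᵗ one
    ‵_  : ∀ q → ‵ q ≈ᵗ ‵ q
    _⊗_ : ∀ {A A' B B'} → A ≈ᵗ A' → B ≈ᵗ B' → A ⊗ B ≈ᵗ A' ⊗ B'
    □   : ∀ {d d' A A'} → d ≃ d' → A ≈ᵗ A' → □ d A ≈ᵗ □ d' A'

  data _≈ᵈ_ : Decl → Decl → Set where
    decl : ∀ {x d d' A A'} → d ≃ d' → A ≈ᵗ A' → x ⦂[ d ] A ≈ᵈ x ⦂[ d' ] A'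

  _≈ᶜ_ : Ctx → Ctx → Set
  _≈ᶜ_ = Pointwise _≈ᵈ_

  ≈ᵗ-refl : ∀ {A} → A ≈ᵗ A
  ≈ᵗ-refl {one}   = one
  ≈ᵗ-refl {‵ q}   = ‵ q
  ≈ᵗ-refl {A ⊗ B} = ≈ᵗ-refl ⊗ ≈ᵗ-refl
  ≈ᵗ-refl {□ d A} = □ Real.≃-refl ≈ᵗ-refl

  ≈ᶜ-refl : ∀ {Γ} → Γ ≈ᶜ Γ
  ≈ᶜ-refl = Pointwise.refl (decl Real.≃-refl ≈ᵗ-refl)

  data Term : Set where
    var   : Var → Term
    ⋆     : Term
    let⋆  : Term → Term → Term
    gate  : Gate → List Term → Term
    ⟨_,_⟩ : Term → Term → Term
    let⊗  : Var → Var → Term → Term → Term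
    box   : ℝ → Term → Term
    let□  : ℝ → Var → Term → Term → Term
    delay : ℝ → Term → Term
    let₁  : Var → Term → Term → Term

  infix 3 _⊢_⦂_ _⊢*_⦂_
  mutual
    data _⊢_⦂_ : Ctx → Term → Ty → Set where
      Swap   : ∀ Γ {a b Δ t C} → Γ ++ a ∷ b ∷ Δ ⊢ t ⦂ C → Γ ++ b ∷ a ∷ Δ ⊢ t ⦂ C
      Var-   : ∀ {x A} → x ⦂[ 0ℝ ] A ∷ [] ⊢ var x ⦂ A
      Unit-I : [] ⊢ ⋆ ⦂ one
      Unit-E : ∀ d {Γ Δ s t A} → Γ ⊢ s ⦂ one → Δ ⊢ t ⦂ A →
               (d +ᶜ Γ) ++ Δ ⊢ let⋆ s t ⦂ A
      Gate-  : ∀ G {Γ ts} → Γ ⊢* ts ⦂ qubits G →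
               (- duration G) +ᶜ Γ ⊢ gate G ts ⦂ ⨂ (qubits G)
      Tens-I : ∀ {Γ Δ s t A B} → Γ ⊢ s ⦂ A → Δ ⊢ t ⦂ B → Γ ++ Δ ⊢ ⟨ s , t ⟩ ⦂ A ⊗ B
      Tens-E : ∀ {d x y Γ Δ s t A B C} → Γ ⊢ s ⦂ A ⊗ B →
               x ⦂[ d ] A ∷ y ⦂[ d ] B ∷ Δ ⊢ t ⦂ C →
               (d +ᶜ Γ) ++ Δ ⊢ let⊗ x y s t ⦂ C
      Box-I  : ∀ d {Γ t A} → Γ ⊢ t ⦂ A → d +ᶜ Γ ⊢ box d t ⦂ □ d A
      Box-E  : ∀ {d e x Γ Δ s t A B} → Γ ⊢ s ⦂ □ d A → x ⦂[ e ] A ∷ Δ ⊢ t ⦂ B →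
               ((e - d) +ᶜ Γ) ++ Δ ⊢ let□ d x s t ⦂ B
      Delay  : ∀ d {Γ t q} → 0ℝ ≤ d → Γ ⊢ t ⦂ ‵ q → (- d) +ᶜ Γ ⊢ delay d t ⦂ ‵ q
      Let    : ∀ {d x Γ Δ s t A C} → Γ ⊢ s ⦂ A → x ⦂[ d ] A ∷ Δ ⊢ t ⦂ C →
               (d +ᶜ Γ) ++ Δ ⊢ let₁ x s t ⦂ C
      -- Judgements that differ by equalities of reals are the same judgement;
      -- as _≃_ is not _≡_, this identification has to be a rule.
      Conv   : ∀ {Γ Γ' t A A'} → Γ' ≈ᶜ Γ → A ≈ᵗ A' → Γ ⊢ t ⦂ A → Γ' ⊢ t ⦂ A'

    -- Γ is the concatenation of contexts Γᵢ with Γᵢ ⊢ tᵢ ⦂ qᵢ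
    data _⊢*_⦂_ : Ctx → List Term → List Qubit → Set where
      []  : [] ⊢* [] ⦂ []
      _∷_ : ∀ {Γ Δ t ts q qs} → Γ ⊢ t ⦂ ‵ q → Δ ⊢* ts ⦂ qs → Γ ++ Δ ⊢* t ∷ ts ⦂ q ∷ qs

  data Elim : Set where
    ⋆≔_      : Var → Elim
    ⟨_,_⟩≔_  : Var → Var → Var → Elim
    box_,_≔_ : ℝ → Var → Var → Elim

  infix 3 _⊸[_]_
  data _⊸[_]_ : Ctx → Elim → Ctx → Set where
    unitₑ : ∀ {x d} → x ⦂[ d ] one ∷ [] ⊸[ ⋆≔ x ] []
    tensₑ : ∀ {x y z d A B} →
            z ⦂[ d ] (A ⊗ B) ∷ [] ⊸[ ⟨ x , y ⟩≔ z ] x ⦂[ d ] A ∷ y ⦂[ d ] B ∷ []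
    boxₑ  : ∀ {x z d e A} →
            z ⦂[ d ] □ e A ∷ [] ⊸[ box e , x ≔ z ] x ⦂[ d + e ] A ∷ []

  letₑ : Elim → Term → Term
  letₑ (⋆≔ x)          t = let⋆ (var x) t
  letₑ (⟨ x , y ⟩≔ z)  t = let⊗ x y (var z) t
  letₑ (box e , x ≔ z) t = let□ e x (var z) t

  -- The derived rule: exchange the eliminated variables to the front, apply the
  -- elimination rule to a variable, and exchange that variable back into place.

  infix 3 _⟿_
  data _⟿_ : Ctx → Ctx → Set where
    adjacent : ∀ Γ {a b Δ} → Γ ++ a ∷ b ∷ Δ ⟿ Γ ++ b ∷ a ∷ Δ

  swaps : ∀ {Γ Γ' t A} → Star _⟿_ Γ Γ' → Γ ⊢ t ⦂ A → Γ' ⊢ t ⦂ A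
  swaps done              D = D
  swaps (adjacent Γ ◅ ss) D = swaps ss (Swap Γ D)

  infixr 5 _∷ˢ_
  _∷ˢ_ : ∀ a {Γ Γ'} → Star _⟿_ Γ Γ' → Star _⟿_ (a ∷ Γ) (a ∷ Γ')
  a ∷ˢ ss = gmap (a ∷_) (λ { (adjacent Γ) → adjacent (a ∷ Γ) }) ss

  toFront : ∀ Θ a Ξ → Star _⟿_ (Θ ++ a ∷ Ξ) (a ∷ Θ ++ Ξ)
  toFront []      a Ξ = done
  toFront (b ∷ Θ) a Ξ = (b ∷ˢ toFront Θ a Ξ) ◅◅ (adjacent [] ◅ done)

  fromFront : ∀ Θ a Ξ → Star _⟿_ (a ∷ Θ ++ Ξ) (Θ ++ a ∷ Ξ)
  fromFront []      a Ξ = done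
  fromFront (b ∷ Θ) a Ξ = adjacent [] ◅ (b ∷ˢ fromFront Θ a Ξ)

  ⊢letₑ : ∀ {e Γ Δ t A} → Γ ⊸[ e ] Δ → ∀ Θ Ξ →
          Θ ++ Δ ++ Ξ ⊢ t ⦂ A → Θ ++ Γ ++ Ξ ⊢ letₑ e t ⦂ A
  ⊢letₑ (unitₑ {x} {d}) Θ Ξ D =
    swaps (fromFront Θ (x ⦂[ d ] one) Ξ)
      (Conv (decl (Real.≃-sym (Real.+-identityʳ d)) ≈ᵗ-refl ∷ ≈ᶜ-refl) ≈ᵗ-refl
        (Unit-E d Var- D))
  ⊢letₑ (tensₑ {x} {y} {z} {d} {A} {B}) Θ Ξ D =
    swaps (fromFront Θ (z ⦂[ d ] (A ⊗ B)) Ξ)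
      (Conv (decl (Real.≃-sym (Real.+-identityʳ d)) ≈ᵗ-refl ∷ ≈ᶜ-refl) ≈ᵗ-refl
        (Tens-E Var-
          (swaps (toFront Θ (x ⦂[ d ] A) (y ⦂[ d ] B ∷ Ξ)
                  ◅◅ (x ⦂[ d ] A ∷ˢ toFront Θ (y ⦂[ d ] B) Ξ)) D)))
  ⊢letₑ (boxₑ {x} {z} {d} {e} {A}) Θ Ξ D =
    swaps (fromFront Θ (z ⦂[ d ] □ e A) Ξ)
      (Conv (decl (Real.≃-sym (Real.≃-trans (Real.+-identityʳ _) (Real.x+y-y≃x d e))) ≈ᵗ-refl
              ∷ ≈ᶜ-refl) ≈ᵗ-refl
        (Box-E Var- (swaps (toFront Θ (x ⦂[ d + e ] A) Ξ) D)))

record ShiftModel (Sig : Signature) (o ℓ e : Level) : Set (lsuc (o ⊔ ℓ ⊔ e)) where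
  open Signature Sig
  open Calculus Sig
  field
    𝒞 : SymmetricMonoidalCategory o ℓ e
  open SymmetricMonoidalCategory 𝒞 public
  field
    X         : Qubit → Obj
    shiftings : MonoidalFunctor (Discrete Real.+-0-monoid) (SymMonEnd 𝒞)

  private
    module S = MonoidalFunctor shiftings
    module End = MonoidalCategory (SymMonEnd 𝒞)
    module Trans {F G} (t : F End.⇒ G) = MonoidalTransformation t

    component : ∀ {F G} → F End.≅ G → ∀ A →
                SymmetricMonoidalFunctor.F₀ F A ≅ SymmetricMonoidalFunctor.F₀ G A
    component {F} {G} i A = record
      { from = Trans.η {F} {G} (End.from i) A
      ; to   = Trans.η {G} {F} (End.to i) A
      ; isoˡ = End.isoˡ i A
      ; isoʳ = End.isoʳ i A
      }

  module Shift (d : ℝ) = SymmetricMonoidalFunctor (S.F₀ d)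

  shift-coe : ∀ {d d'} → d ≃ d' → ∀ A → Shift.F₀ d A ⇒ Shift.F₀ d' A
  shift-coe {d} {d'} p = Trans.η {S.F₀ d} {S.F₀ d'} (S.F₁ p)

  shift-0 : ∀ A → A ≅ Shift.F₀ 0ℝ A
  shift-0 = component S.ε-iso

  shift-+ : ∀ d d' A → Shift.F₀ d (Shift.F₀ d' A) ≅ Shift.F₀ (d + d') A
  shift-+ d d' = component (S.μ-iso {d} {d'})

  ⟦_⟧ᵗ : Ty → Obj
  ⟦ one ⟧ᵗ   = unit
  ⟦ ‵ q ⟧ᵗ   = X q
  ⟦ A ⊗ B ⟧ᵗ = ⟦ A ⟧ᵗ ⊗₀ ⟦ B ⟧ᵗ
  ⟦ □ d A ⟧ᵗ = Shift.F₀ d ⟦ A ⟧ᵗ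

  ⟦_⟧ᵈ : Decl → Obj
  ⟦ x ⦂[ d ] A ⟧ᵈ = Shift.F₀ d ⟦ A ⟧ᵗ

  ⟦_⟧ᶜ : Ctx → Obj
  ⟦ [] ⟧ᶜ    = unit
  ⟦ a ∷ Γ ⟧ᶜ = ⟦ a ⟧ᵈ ⊗₀ ⟦ Γ ⟧ᶜ

record Model (Sig : Signature) (o ℓ e : Level) : Set (lsuc (o ⊔ ℓ ⊔ e)) where
  open Signature Sig
  open Calculus Sig
  field
    shiftModel : ShiftModel Sig o ℓ e
  open ShiftModel shiftModel public
  field
    gateₘ  : ∀ G → Shift.F₀ (- duration G) ⟦ ⨂ (qubits G) ⟧ᵗ ⇒ ⟦ ⨂ (qubits G) ⟧ᵗ
    delayₘ : ∀ x q → Shift.F₀ (- x) (X q) ⇒ X q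
    -- delayₘ is a function of real numbers, so it respects their equality
    delayₘ-resp : ∀ {x y} (p : x ≃ y) q →
                  delayₘ y q ∘ shift-coe (Real.-‿cong p) (X q) ≈ delayₘ x q

module Interpretation {Sig : Signature} {o ℓ e : Level} (M : Model Sig o ℓ e) where

  open Signature Sig
  open Calculus Sig
  open Model M

  append : ∀ Γ Δ → ⟦ Γ ++ Δ ⟧ᶜ ≅ ⟦ Γ ⟧ᶜ ⊗₀ ⟦ Δ ⟧ᶜ
  append []      Δ = ≅-sym unitorˡ
  append (a ∷ Γ) Δ = ≅-refl ⊗≅ append Γ Δ ⟫ ≅-sym associator

  shiftCtx : ∀ d Γ → ⟦ d +ᶜ Γ ⟧ᶜ ≅ Shift.F₀ d ⟦ Γ ⟧ᶜ
  shiftCtx d []                = Shift.ε-iso d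
  shiftCtx d (x ⦂[ e ] A ∷ Γ) = ≅-sym (shift-+ d e ⟦ A ⟧ᵗ) ⊗≅ shiftCtx d Γ ⟫ Shift.μ-iso d

  shiftAppend : ∀ d Γ Δ → ⟦ (d +ᶜ Γ) ++ Δ ⟧ᶜ ≅ Shift.F₀ d ⟦ Γ ⟧ᶜ ⊗₀ ⟦ Δ ⟧ᶜ
  shiftAppend d Γ Δ = append (d +ᶜ Γ) Δ ⟫ shiftCtx d Γ ⊗≅ ≅-refl

  shiftTensor : ∀ d A B C → Shift.F₀ d (A ⊗₀ B) ⊗₀ C ≅ Shift.F₀ d A ⊗₀ (Shift.F₀ d B ⊗₀ C)
  shiftTensor d A B C = ≅-sym (Shift.μ-iso d) ⊗≅ ≅-refl ⟫ associator

  dropUnit : ∀ d A → Shift.F₀ d unit ⊗₀ A ≅ A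
  dropUnit d A = ≅-sym (Shift.ε-iso d) ⊗≅ ≅-refl ⟫ unitorˡ

  coeᵗ : ∀ {A B} → A ≈ᵗ B → ⟦ A ⟧ᵗ ⇒ ⟦ B ⟧ᵗ
  coeᵗ one                   = id
  coeᵗ (‵ q)                 = id
  coeᵗ (p ⊗ q)               = coeᵗ p ⊗₁ coeᵗ q
  coeᵗ (□ {d} {A' = A'} r p) = shift-coe r ⟦ A' ⟧ᵗ ∘ Shift.F₁ d (coeᵗ p)

  coeᵈ : ∀ {a b} → a ≈ᵈ b → ⟦ a ⟧ᵈ ⇒ ⟦ b ⟧ᵈ
  coeᵈ (decl {d = d} {A' = A'} r p) = shift-coe r ⟦ A' ⟧ᵗ ∘ Shift.F₁ d (coeᵗ p)

  coeᶜ : ∀ {Γ Δ} → Γ ≈ᶜ Δ → ⟦ Γ ⟧ᶜ ⇒ ⟦ Δ ⟧ᶜ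
  coeᶜ []       = id
  coeᶜ (p ∷ ps) = coeᵈ p ⊗₁ coeᶜ ps

  swapᶜ : ∀ Γ a b Δ → ⟦ Γ ++ a ∷ b ∷ Δ ⟧ᶜ ⇒ ⟦ Γ ++ b ∷ a ∷ Δ ⟧ᶜ
  swapᶜ []      a b Δ = α⇒ ∘ (σ ⊗₁ id) ∘ to associator
  swapᶜ (c ∷ Γ) a b Δ = id ⊗₁ swapᶜ Γ a b Δ

  mutual
    ⟦_⟧ : ∀ {Γ t A} → Γ ⊢ t ⦂ A → ⟦ Γ ⟧ᶜ ⇒ ⟦ A ⟧ᵗ
    ⟦ Swap Γ {a} {b} {Δ} D ⟧ = ⟦ D ⟧ ∘ swapᶜ Γ b a Δ
    ⟦ Var- ⟧ = to (shift-0 _) ∘ ρ⇒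
    ⟦ Unit-I ⟧ = id
    ⟦ Unit-E d {Γ} {Δ} {A = A} D E ⟧ =
      from (dropUnit d ⟦ A ⟧ᵗ) ∘ (Shift.F₁ d ⟦ D ⟧ ⊗₁ ⟦ E ⟧) ∘ from (shiftAppend d Γ Δ)
    ⟦ Gate- G {Γ} Ds ⟧ =
      gateₘ G ∘ Shift.F₁ (- duration G) ⟦ Ds ⟧* ∘ from (shiftCtx (- duration G) Γ)
    ⟦ Tens-I {Γ} {Δ} D E ⟧ = (⟦ D ⟧ ⊗₁ ⟦ E ⟧) ∘ from (append Γ Δ)
    ⟦ Tens-E {d} {Γ = Γ} {Δ} {A = A} {B} D E ⟧ =
      ⟦ E ⟧ ∘ from (shiftTensor d ⟦ A ⟧ᵗ ⟦ B ⟧ᵗ ⟦ Δ ⟧ᶜ)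
            ∘ (Shift.F₁ d ⟦ D ⟧ ⊗₁ id) ∘ from (shiftAppend d Γ Δ)
    ⟦ Box-I d {Γ} D ⟧ = Shift.F₁ d ⟦ D ⟧ ∘ from (shiftCtx d Γ)
    ⟦ Box-E {d} {e} {Γ = Γ} {Δ} {A = A} D E ⟧ =
      ⟦ E ⟧ ∘ ((shift-coe (Real.x-y+y≃x e d) ⟦ A ⟧ᵗ ∘ from (shift-+ (e - d) d ⟦ A ⟧ᵗ)) ⊗₁ id)
            ∘ (Shift.F₁ (e - d) ⟦ D ⟧ ⊗₁ id) ∘ from (shiftAppend (e - d) Γ Δ)
    ⟦ Delay d {Γ} {q = q} _ D ⟧ =
      delayₘ d q ∘ Shift.F₁ (- d) ⟦ D ⟧ ∘ from (shiftCtx (- d) Γ)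
    ⟦ Let {d} {Γ = Γ} {Δ} D E ⟧ =
      ⟦ E ⟧ ∘ (Shift.F₁ d ⟦ D ⟧ ⊗₁ id) ∘ from (shiftAppend d Γ Δ)
    ⟦ Conv p q D ⟧ = coeᵗ q ∘ ⟦ D ⟧ ∘ coeᶜ p

    ⟦_⟧* : ∀ {Γ ts qs} → Γ ⊢* ts ⦂ qs → ⟦ Γ ⟧ᶜ ⇒ ⟦ ⨂ qs ⟧ᵗ
    ⟦ [] ⟧* = id
    ⟦ _∷_ {Γ} {qs = []} D [] ⟧* = ⟦ D ⟧ ∘ ρ⇒ ∘ from (append Γ [])
    ⟦ _∷_ {Γ} {Δ} {qs = _ ∷ _} D Ds ⟧* = (⟦ D ⟧ ⊗₁ ⟦ Ds ⟧*) ∘ from (append Γ Δ)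

  -- The coherence isomorphism between the two contexts of an eliminator, along
  -- which the interpretations of let e in t and of t are compared.

  elim-iso : ∀ {e Γ Δ} → Γ ⊸[ e ] Δ → ∀ Θ Ξ → ⟦ Θ ++ Γ ++ Ξ ⟧ᶜ ≅ ⟦ Θ ++ Δ ++ Ξ ⟧ᶜ
  elim-iso p (a ∷ Θ) Ξ = ≅-refl ⊗≅ elim-iso p Θ Ξ
  elim-iso (unitₑ {d = d}) [] Ξ = dropUnit d ⟦ Ξ ⟧ᶜ
  elim-iso (tensₑ {d = d} {A} {B}) [] Ξ = shiftTensor d ⟦ A ⟧ᵗ ⟦ B ⟧ᵗ ⟦ Ξ ⟧ᶜ
  elim-iso (boxₑ {d = d} {e} {A}) [] Ξ = shift-+ d e ⟦ A ⟧ᵗ ⊗≅ ≅-refl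

{-# OPTIONS --safe #-}
module Submission where

-- Eliminating a variable at the front of the context is a morphism f ⊗ id (followed
-- by an associator or a left unitor), because the coherence isomorphism attached to
-- the variable rule cancels the change of grade d ≃ d + 0.  Moving a variable to the
-- front is an iterated symmetry.  Conjugating by it turns elimination at the front
-- into elimination in place: this is naturality of the symmetry for box, the hexagon
-- for ⊗, and the compatibility of the symmetry with the unitors for 1.

open import Data.List.Base using ([]; _∷_; _++_)
open import Data.List.Relation.Binary.Pointwise using ([]; _∷_)
open import Data.Unit.Base using (tt)
open import Relation.Binary.Construct.Closure.ReflexiveTransitive using (Star; _◅_; _◅◅_) renaming (ε to done)
open import Defs

module SymmetricCoherence {o ℓ e} (𝒞 : SymmetricMonoidalCategory o ℓ e) where

  open SymmetricMonoidalCategory 𝒞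
  open HomReasoning

  α⇐ : ∀ {A B C} → (A ⊗₀ (B ⊗₀ C)) ⇒ ((A ⊗₀ B) ⊗₀ C)
  α⇐ = to associator

  λ⇐ : ∀ {A} → A ⇒ (unit ⊗₀ A)
  λ⇐ = to unitorˡ

  cancelˡ : ∀ {A B C} {h : B ⇒ C} {g : C ⇒ B} {f : A ⇒ B} → g ∘ h ≈ id → g ∘ (h ∘ f) ≈ f
  cancelˡ p = Equiv.trans (pullˡ p) identityˡ

  cancelʳ : ∀ {A B C} {h : A ⇒ B} {g : B ⇒ A} {f : A ⇒ C} → g ∘ h ≈ id → (f ∘ g) ∘ h ≈ f
  cancelʳ p = Equiv.trans assoc (Equiv.trans (refl⟩∘⟨ p) identityʳ)

  iso-monic : ∀ {A B C} {f g : A ⇒ B} (i : B ≅ C) → from i ∘ f ≈ from i ∘ g → f ≈ g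
  iso-monic i p = Equiv.trans (Equiv.sym (cancelˡ (isoˡ i)))
                    (Equiv.trans (refl⟩∘⟨ p) (cancelˡ (isoˡ i)))

  iso-epic : ∀ {A B C} {f g : B ⇒ C} (i : A ≅ B) → f ∘ from i ≈ g ∘ from i → f ≈ g
  iso-epic i p = Equiv.trans (Equiv.sym (cancelʳ (isoʳ i)))
                   (Equiv.trans (p ⟩∘⟨refl) (cancelʳ (isoʳ i)))

  ⊗-≈ˡ : ∀ {A B C} {f g : A ⇒ B} → f ≈ g → f ⊗₁ id {C} ≈ g ⊗₁ id
  ⊗-≈ˡ p = ⊗-resp-≈ p Equiv.refl

  ⊗-≈ʳ : ∀ {A B C} {f g : A ⇒ B} → f ≈ g → id {C} ⊗₁ f ≈ id ⊗₁ g
  ⊗-≈ʳ p = ⊗-resp-≈ Equiv.refl p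

  ⊗-splitˡ : ∀ {A B C D} {f : B ⇒ C} {g : A ⇒ B} → (f ∘ g) ⊗₁ id {D} ≈ (f ⊗₁ id) ∘ (g ⊗₁ id)
  ⊗-splitˡ = Equiv.trans (⊗-resp-≈ Equiv.refl (Equiv.sym identityˡ)) ⊗-homo

  ⊗-splitʳ : ∀ {A B C D} {f : B ⇒ C} {g : A ⇒ B} → id {D} ⊗₁ (f ∘ g) ≈ (id ⊗₁ f) ∘ (id ⊗₁ g)
  ⊗-splitʳ = Equiv.trans (⊗-resp-≈ (Equiv.sym identityˡ) Equiv.refl) ⊗-homo

  ⊗-interchange : ∀ {A B C D} {f : A ⇒ B} {g : C ⇒ D} →
                  (f ⊗₁ id) ∘ (id ⊗₁ g) ≈ (id ⊗₁ g) ∘ (f ⊗₁ id)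
  ⊗-interchange = Equiv.trans (Equiv.sym ⊗-homo)
    (Equiv.trans (⊗-resp-≈ (Equiv.trans identityʳ (Equiv.sym identityˡ))
                           (Equiv.trans identityˡ (Equiv.sym identityʳ))) ⊗-homo)

  α⇐-natural : ∀ {A B C A' B' C'} {f : A ⇒ A'} {g : B ⇒ B'} {h : C ⇒ C'} →
               α⇐ ∘ (f ⊗₁ (g ⊗₁ h)) ≈ ((f ⊗₁ g) ⊗₁ h) ∘ α⇐
  α⇐-natural {f = f} {g} {h} = iso-epic associator (begin
    (α⇐ ∘ (f ⊗₁ (g ⊗₁ h))) ∘ α⇒    ≈⟨ assoc ⟩
    α⇐ ∘ ((f ⊗₁ (g ⊗₁ h)) ∘ α⇒)    ≈⟨ refl⟩∘⟨ associator-natural ⟨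
    α⇐ ∘ (α⇒ ∘ ((f ⊗₁ g) ⊗₁ h))    ≈⟨ cancelˡ (isoˡ associator) ⟩
    (f ⊗₁ g) ⊗₁ h                  ≈⟨ cancelʳ (isoˡ associator) ⟨
    (((f ⊗₁ g) ⊗₁ h) ∘ α⇐) ∘ α⇒    ∎)

  unit⊗-faithful : ∀ {A B} {f g : A ⇒ B} → id {unit} ⊗₁ f ≈ id ⊗₁ g → f ≈ g
  unit⊗-faithful p = iso-epic unitorˡ
    (Equiv.trans (Equiv.sym unitorˡ-natural) (Equiv.trans (refl⟩∘⟨ p) unitorˡ-natural))

  ⊗unit-faithful : ∀ {A B} {f g : A ⇒ B} → f ⊗₁ id {unit} ≈ g ⊗₁ id → f ≈ g
  ⊗unit-faithful p = iso-epic unitorʳ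
    (Equiv.trans (Equiv.sym unitorʳ-natural) (Equiv.trans (refl⟩∘⟨ p) unitorʳ-natural))

  triangle⁻¹ : ∀ {A B} → (ρ⇒ {A} ⊗₁ id {B}) ∘ (α⇐ ∘ (id ⊗₁ λ⇐)) ≈ id
  triangle⁻¹ = begin
    (ρ⇒ ⊗₁ id) ∘ (α⇐ ∘ (id ⊗₁ λ⇐))            ≈⟨ triangle ⟩∘⟨refl ⟨
    ((id ⊗₁ λ⇒) ∘ α⇒) ∘ (α⇐ ∘ (id ⊗₁ λ⇐))     ≈⟨ assoc ⟩
    (id ⊗₁ λ⇒) ∘ (α⇒ ∘ (α⇐ ∘ (id ⊗₁ λ⇐)))     ≈⟨ refl⟩∘⟨ cancelˡ (isoʳ associator) ⟩
    (id ⊗₁ λ⇒) ∘ (id ⊗₁ λ⇐)                   ≈⟨ ⊗-splitʳ ⟨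
    id ⊗₁ (λ⇒ ∘ λ⇐)                           ≈⟨ ⊗-≈ʳ (isoʳ unitorˡ) ⟩
    id ⊗₁ id                                  ≈⟨ ⊗-identity ⟩
    id                                        ∎

  λ⇒-α⇒ : ∀ {A B} → λ⇒ ∘ α⇒ ≈ λ⇒ {A} ⊗₁ id {B}
  λ⇒-α⇒ = unit⊗-faithful (iso-epic (associator ⊗≅ ≅-refl ⟫ associator) (begin
    (id ⊗₁ (λ⇒ ∘ α⇒)) ∘ (α⇒ ∘ (α⇒ ⊗₁ id))           ≈⟨ ⊗-splitʳ ⟩∘⟨refl ⟩
    ((id ⊗₁ λ⇒) ∘ (id ⊗₁ α⇒)) ∘ (α⇒ ∘ (α⇒ ⊗₁ id))   ≈⟨ assoc ⟩
    (id ⊗₁ λ⇒) ∘ ((id ⊗₁ α⇒) ∘ (α⇒ ∘ (α⇒ ⊗₁ id)))   ≈⟨ refl⟩∘⟨ pentagon ⟩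
    (id ⊗₁ λ⇒) ∘ (α⇒ ∘ α⇒)                          ≈⟨ pullˡ triangle ⟩
    (ρ⇒ ⊗₁ id) ∘ α⇒                                 ≈⟨ ⊗-resp-≈ Equiv.refl ⊗-identity ⟩∘⟨refl ⟨
    (ρ⇒ ⊗₁ (id ⊗₁ id)) ∘ α⇒                         ≈⟨ associator-natural ⟨
    α⇒ ∘ ((ρ⇒ ⊗₁ id) ⊗₁ id)                         ≈⟨ refl⟩∘⟨ ⊗-≈ˡ triangle ⟨
    α⇒ ∘ (((id ⊗₁ λ⇒) ∘ α⇒) ⊗₁ id)                  ≈⟨ refl⟩∘⟨ ⊗-splitˡ ⟩
    α⇒ ∘ (((id ⊗₁ λ⇒) ⊗₁ id) ∘ (α⇒ ⊗₁ id))          ≈⟨ extendˡ associator-natural ⟩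
    (id ⊗₁ (λ⇒ ⊗₁ id)) ∘ (α⇒ ∘ (α⇒ ⊗₁ id))          ∎))

  λ⇒-σ : ∀ {A} → λ⇒ ∘ σ ≈ ρ⇒ {A}
  λ⇒-σ = ⊗unit-faithful (iso-monic σ-iso (begin
    σ ∘ ((λ⇒ ∘ σ) ⊗₁ id)                     ≈⟨ refl⟩∘⟨ ⊗-splitˡ ⟩
    σ ∘ ((λ⇒ ⊗₁ id) ∘ (σ ⊗₁ id))             ≈⟨ refl⟩∘⟨ pullˡ λ⇒-α⇒ ⟨
    σ ∘ (λ⇒ ∘ (α⇒ ∘ (σ ⊗₁ id)))              ≈⟨ extendˡ unitorˡ-natural ⟨
    λ⇒ ∘ ((id ⊗₁ σ) ∘ (α⇒ ∘ (σ ⊗₁ id)))      ≈⟨ refl⟩∘⟨ hexagon ⟩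
    λ⇒ ∘ (α⇒ ∘ (σ ∘ α⇒))                     ≈⟨ pullˡ λ⇒-α⇒ ⟩
    (λ⇒ ⊗₁ id) ∘ (σ ∘ α⇒)                    ≈⟨ extendˡ σ-natural ⟨
    σ ∘ ((id ⊗₁ λ⇒) ∘ α⇒)                    ≈⟨ refl⟩∘⟨ triangle ⟩
    σ ∘ (ρ⇒ ⊗₁ id)                           ∎))
    where
    σ-iso : ∀ {A B} → A ⊗₀ B ≅ B ⊗₀ A
    σ-iso = record { from = σ ; to = σ ; isoˡ = σ-involutive ; isoʳ = σ-involutive }

  exchange : ∀ {A B C} → (A ⊗₀ (B ⊗₀ C)) ⇒ (B ⊗₀ (A ⊗₀ C))
  exchange = α⇒ ∘ (σ ⊗₁ id) ∘ α⇐

  exchange-natural : ∀ {A B C A' B' C'} {f : A ⇒ A'} {g : B ⇒ B'} {h : C ⇒ C'} →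
                     exchange ∘ (f ⊗₁ (g ⊗₁ h)) ≈ (g ⊗₁ (f ⊗₁ h)) ∘ exchange
  exchange-natural {f = f} {g} {h} = begin
    (α⇒ ∘ ((σ ⊗₁ id) ∘ α⇐)) ∘ (f ⊗₁ (g ⊗₁ h))    ≈⟨ assoc ⟩
    α⇒ ∘ (((σ ⊗₁ id) ∘ α⇐) ∘ (f ⊗₁ (g ⊗₁ h)))    ≈⟨ refl⟩∘⟨ assoc ⟩
    α⇒ ∘ ((σ ⊗₁ id) ∘ (α⇐ ∘ (f ⊗₁ (g ⊗₁ h))))    ≈⟨ refl⟩∘⟨ refl⟩∘⟨ α⇐-natural ⟩
    α⇒ ∘ ((σ ⊗₁ id) ∘ (((f ⊗₁ g) ⊗₁ h) ∘ α⇐))    ≈⟨ refl⟩∘⟨ extendˡ σ⊗id-natural ⟩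
    α⇒ ∘ (((g ⊗₁ f) ⊗₁ h) ∘ ((σ ⊗₁ id) ∘ α⇐))    ≈⟨ extendˡ associator-natural ⟩
    (g ⊗₁ (f ⊗₁ h)) ∘ (α⇒ ∘ ((σ ⊗₁ id) ∘ α⇐))    ∎
    where
    σ⊗id-natural : (σ ⊗₁ id) ∘ ((f ⊗₁ g) ⊗₁ h) ≈ ((g ⊗₁ f) ⊗₁ h) ∘ (σ ⊗₁ id)
    σ⊗id-natural = Equiv.trans (Equiv.sym ⊗-homo)
      (Equiv.trans (⊗-resp-≈ σ-natural (Equiv.trans identityˡ (Equiv.sym identityʳ))) ⊗-homo)

  exchange-involutive : ∀ {A B C} → exchange ∘ exchange ≈ id {A ⊗₀ (B ⊗₀ C)}
  exchange-involutive = begin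
    (α⇒ ∘ ((σ ⊗₁ id) ∘ α⇐)) ∘ (α⇒ ∘ ((σ ⊗₁ id) ∘ α⇐))   ≈⟨ assoc ⟩
    α⇒ ∘ (((σ ⊗₁ id) ∘ α⇐) ∘ (α⇒ ∘ ((σ ⊗₁ id) ∘ α⇐)))   ≈⟨ refl⟩∘⟨ assoc ⟩
    α⇒ ∘ ((σ ⊗₁ id) ∘ (α⇐ ∘ (α⇒ ∘ ((σ ⊗₁ id) ∘ α⇐))))   ≈⟨ refl⟩∘⟨ refl⟩∘⟨ cancelˡ (isoˡ associator) ⟩
    α⇒ ∘ ((σ ⊗₁ id) ∘ ((σ ⊗₁ id) ∘ α⇐))                 ≈⟨ refl⟩∘⟨ cancelˡ σ⊗id-involutive ⟩
    α⇒ ∘ α⇐                                             ≈⟨ isoʳ associator ⟩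
    id                                                  ∎
    where
    σ⊗id-involutive : ∀ {A B C} → (σ {A} {B} ⊗₁ id {C}) ∘ (σ ⊗₁ id) ≈ id
    σ⊗id-involutive = Equiv.trans (Equiv.sym ⊗-splitˡ)
      (Equiv.trans (⊗-≈ˡ σ-involutive) ⊗-identity)

  exchange-unit : ∀ {A B C} {u : B ⇒ unit} →
                  (λ⇒ ∘ (u ⊗₁ id)) ∘ exchange {A} {B} {C} ≈ id ⊗₁ (λ⇒ ∘ (u ⊗₁ id))
  exchange-unit {u = u} = begin
    (λ⇒ ∘ (u ⊗₁ id)) ∘ exchange                ≈⟨ assoc ⟩
    λ⇒ ∘ ((u ⊗₁ id) ∘ exchange)                ≈⟨ refl⟩∘⟨ (⊗-resp-≈ Equiv.refl (Equiv.sym ⊗-identity) ⟩∘⟨refl) ⟩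
    λ⇒ ∘ ((u ⊗₁ (id ⊗₁ id)) ∘ exchange)        ≈⟨ refl⟩∘⟨ exchange-natural ⟨
    λ⇒ ∘ (exchange ∘ (id ⊗₁ (u ⊗₁ id)))        ≈⟨ pullˡ λ⇒-exchange ⟩
    (id ⊗₁ λ⇒) ∘ (id ⊗₁ (u ⊗₁ id))             ≈⟨ ⊗-splitʳ ⟨
    id ⊗₁ (λ⇒ ∘ (u ⊗₁ id))                     ∎
    where
    λ⇒-exchange : ∀ {A C} → λ⇒ ∘ exchange {A} {unit} {C} ≈ id ⊗₁ λ⇒
    λ⇒-exchange = begin
      λ⇒ ∘ (α⇒ ∘ ((σ ⊗₁ id) ∘ α⇐))       ≈⟨ pullˡ λ⇒-α⇒ ⟩
      (λ⇒ ⊗₁ id) ∘ ((σ ⊗₁ id) ∘ α⇐)      ≈⟨ pullˡ (Equiv.sym ⊗-splitˡ) ⟩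
      ((λ⇒ ∘ σ) ⊗₁ id) ∘ α⇐              ≈⟨ ⊗-≈ˡ λ⇒-σ ⟩∘⟨refl ⟩
      (ρ⇒ ⊗₁ id) ∘ α⇐                    ≈⟨ triangle ⟩∘⟨refl ⟨
      ((id ⊗₁ λ⇒) ∘ α⇒) ∘ α⇐             ≈⟨ cancelʳ (isoʳ associator) ⟩
      id ⊗₁ λ⇒                           ∎

  -- The hexagon tensored with R, compared on ((A ⊗ B) ⊗ C) ⊗ R so that the pentagon applies.
  exchange-⊗ : ∀ {A B C R} → α⇒ ∘ exchange {A} {B ⊗₀ C} {R}
                           ≈ ((id ⊗₁ exchange) ∘ exchange) ∘ (id ⊗₁ α⇒)
  exchange-⊗ = iso-epic (associator ⊗≅ ≅-refl ⟫ associator) (begin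
    (α⇒ ∘ (α⇒ ∘ ((σ ⊗₁ id) ∘ α⇐))) ∘ (α⇒ ∘ (α⇒ ⊗₁ id))
      ≈⟨ Equiv.trans assoc (refl⟩∘⟨ Equiv.trans assoc (refl⟩∘⟨ assoc)) ⟩
    α⇒ ∘ (α⇒ ∘ ((σ ⊗₁ id) ∘ (α⇐ ∘ (α⇒ ∘ (α⇒ ⊗₁ id)))))
      ≈⟨ refl⟩∘⟨ refl⟩∘⟨ refl⟩∘⟨ cancelˡ (isoˡ associator) ⟩
    α⇒ ∘ (α⇒ ∘ ((σ ⊗₁ id) ∘ (α⇒ ⊗₁ id)))
      ≈⟨ pentagon-∘ ⟨
    (id ⊗₁ α⇒) ∘ (α⇒ ∘ ((α⇒ ⊗₁ id) ∘ ((σ ⊗₁ id) ∘ (α⇒ ⊗₁ id))))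
      ≈⟨ refl⟩∘⟨ refl⟩∘⟨ hexagon⊗id ⟩
    (id ⊗₁ α⇒) ∘ (α⇒ ∘ (((id ⊗₁ σ) ⊗₁ id) ∘ ((α⇒ ⊗₁ id) ∘ ((σ ⊗₁ id) ⊗₁ id))))
      ≈⟨ refl⟩∘⟨ extendˡ associator-natural ⟩
    (id ⊗₁ α⇒) ∘ ((id ⊗₁ (σ ⊗₁ id)) ∘ (α⇒ ∘ ((α⇒ ⊗₁ id) ∘ ((σ ⊗₁ id) ⊗₁ id))))
      ≈⟨ refl⟩∘⟨ refl⟩∘⟨ cancelˡ id⊗α⇐α⇒ ⟨
    (id ⊗₁ α⇒) ∘ ((id ⊗₁ (σ ⊗₁ id)) ∘ ((id ⊗₁ α⇐) ∘
      ((id ⊗₁ α⇒) ∘ (α⇒ ∘ ((α⇒ ⊗₁ id) ∘ ((σ ⊗₁ id) ⊗₁ id))))))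
      ≈⟨ refl⟩∘⟨ refl⟩∘⟨ refl⟩∘⟨ pentagon-∘ ⟩
    (id ⊗₁ α⇒) ∘ ((id ⊗₁ (σ ⊗₁ id)) ∘ ((id ⊗₁ α⇐) ∘ (α⇒ ∘ (α⇒ ∘ ((σ ⊗₁ id) ⊗₁ id)))))
      ≈⟨ Equiv.trans (refl⟩∘⟨ pullˡ (Equiv.sym ⊗-splitʳ)) (pullˡ (Equiv.sym ⊗-splitʳ)) ⟩
    (id ⊗₁ exchange) ∘ (α⇒ ∘ (α⇒ ∘ ((σ ⊗₁ id) ⊗₁ id)))
      ≈⟨ refl⟩∘⟨ refl⟩∘⟨ Equiv.trans associator-natural (⊗-resp-≈ Equiv.refl ⊗-identity ⟩∘⟨refl) ⟩
    (id ⊗₁ exchange) ∘ (α⇒ ∘ ((σ ⊗₁ id) ∘ α⇒))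
      ≈⟨ refl⟩∘⟨ refl⟩∘⟨ refl⟩∘⟨ Equiv.trans (refl⟩∘⟨ pentagon) (cancelˡ (isoˡ associator)) ⟨
    (id ⊗₁ exchange) ∘ (α⇒ ∘ ((σ ⊗₁ id) ∘ (α⇐ ∘ ((id ⊗₁ α⇒) ∘ (α⇒ ∘ (α⇒ ⊗₁ id))))))
      ≈⟨ refl⟩∘⟨ Equiv.trans assoc (refl⟩∘⟨ assoc) ⟨
    (id ⊗₁ exchange) ∘ (exchange ∘ ((id ⊗₁ α⇒) ∘ (α⇒ ∘ (α⇒ ⊗₁ id))))
      ≈⟨ Equiv.trans assoc assoc ⟨
    (((id ⊗₁ exchange) ∘ exchange) ∘ (id ⊗₁ α⇒)) ∘ (α⇒ ∘ (α⇒ ⊗₁ id)) ∎)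
    where
    pentagon-∘ : ∀ {A B C D Z} {k : Z ⇒ (((A ⊗₀ B) ⊗₀ C) ⊗₀ D)} →
                 (id ⊗₁ α⇒) ∘ (α⇒ ∘ ((α⇒ ⊗₁ id) ∘ k)) ≈ α⇒ ∘ (α⇒ ∘ k)
    pentagon-∘ = Equiv.trans (refl⟩∘⟨ Equiv.sym assoc)
      (Equiv.trans (pullˡ pentagon) assoc)

    id⊗α⇐α⇒ : ∀ {A B C D} → (id {A} ⊗₁ α⇐ {B} {C} {D}) ∘ (id ⊗₁ α⇒) ≈ id
    id⊗α⇐α⇒ = Equiv.trans (Equiv.sym ⊗-splitʳ) (Equiv.trans (⊗-≈ʳ (isoˡ associator)) ⊗-identity)

    hexagon⊗id : ∀ {A B C D} →
      (α⇒ ⊗₁ id) ∘ ((σ ⊗₁ id) ∘ (α⇒ {A} {B} {C} ⊗₁ id {D})) ≈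
      ((id ⊗₁ σ) ⊗₁ id) ∘ ((α⇒ ⊗₁ id) ∘ ((σ ⊗₁ id) ⊗₁ id))
    hexagon⊗id = begin
      (α⇒ ⊗₁ id) ∘ ((σ ⊗₁ id) ∘ (α⇒ ⊗₁ id))                 ≈⟨ ⊗-splitˡ₃ ⟨
      (α⇒ ∘ (σ ∘ α⇒)) ⊗₁ id                                 ≈⟨ ⊗-≈ˡ hexagon ⟨
      ((id ⊗₁ σ) ∘ (α⇒ ∘ (σ ⊗₁ id))) ⊗₁ id                  ≈⟨ ⊗-splitˡ₃ ⟩
      ((id ⊗₁ σ) ⊗₁ id) ∘ ((α⇒ ⊗₁ id) ∘ ((σ ⊗₁ id) ⊗₁ id))  ∎
      where
      ⊗-splitˡ₃ : ∀ {A B C D E} {f : A ⇒ B} {g : B ⇒ C} {h : C ⇒ D} →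
                  (h ∘ (g ∘ f)) ⊗₁ id {E} ≈ (h ⊗₁ id) ∘ ((g ⊗₁ id) ∘ (f ⊗₁ id))
      ⊗-splitˡ₃ = Equiv.trans ⊗-splitˡ (refl⟩∘⟨ ⊗-splitˡ)

module ShiftCoherence {Sig : Signature} {o ℓ e} (M : Model Sig o ℓ e) where

  open Calculus Sig
  open Model M
  open Interpretation M
  open SymmetricCoherence 𝒞
  open HomReasoning

  private
    module S = MonoidalFunctor shiftings

  shift-coe-irrelevant : ∀ {d d'} (p q : d ≃ d') {A} → shift-coe p A ≈ shift-coe q A
  shift-coe-irrelevant p q {A} = S.F-resp-≈ {f = p} {g = q} tt A

  shift-coe-∘ : ∀ {c d d'} (p : c ≃ d) (q : d ≃ d') (r : c ≃ d') {A} →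
                shift-coe q A ∘ shift-coe p A ≈ shift-coe r A
  shift-coe-∘ p q r {A} = Equiv.trans (Equiv.sym (S.homomorphism {f = p} {g = q} A))
                                      (shift-coe-irrelevant (Real.≃-trans p q) r)

  shift-coe-loop : ∀ {d} (p : d ≃ d) {A} → shift-coe p A ≈ id
  shift-coe-loop {d} p {A} = Equiv.trans (shift-coe-irrelevant p Real.≃-refl) (S.identity {d} A)

  shift-+-coe : ∀ {c d} (p : c ≃ d) {d' A} (r : c + d' ≃ d + d') →
                from (shift-+ d d' A) ∘ shift-coe p (Shift.F₀ d' A)
                ≈ shift-coe r A ∘ from (shift-+ c d' A)
  shift-+-coe {c} {d} p {d'} {A} r = begin
    from (shift-+ d d' A) ∘ shift-coe p _
      ≈⟨ refl⟩∘⟨ Equiv.trans (F-id ⟩∘⟨refl) identityˡ ⟨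
    from (shift-+ d d' A) ∘ (Shift.F₁ d (shift-coe Real.≃-refl A) ∘ shift-coe p _)
      ≈⟨ S.μ-natural {f = p} {g = Real.≃-refl} A ⟩
    shift-coe (Real.+-cong p Real.≃-refl) A ∘ from (shift-+ c d' A)
      ≈⟨ shift-coe-irrelevant _ r ⟩∘⟨refl ⟩
    shift-coe r A ∘ from (shift-+ c d' A) ∎
    where
    F-id : Shift.F₁ d (shift-coe (Real.≃-refl {d'}) A) ≈ id
    F-id = Equiv.trans (Shift.F-resp-≈ d (shift-coe-loop Real.≃-refl)) (Shift.identity d)

  shift-+-0 : ∀ d {A} → Shift.F₁ d (to (shift-0 A)) ∘ to (shift-+ d 0ℝ A)
                        ≈ shift-coe (Real.+-identityʳ d) A
  shift-+-0 d {A} = iso-epic (Shift.F-≅ d (shift-0 A) ⟫ shift-+ d 0ℝ A) (begin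
    (Shift.F₁ d (to (shift-0 A)) ∘ to (shift-+ d 0ℝ A))
      ∘ (from (shift-+ d 0ℝ A) ∘ Shift.F₁ d (from (shift-0 A)))
      ≈⟨ isoˡ (Shift.F-≅ d (shift-0 A) ⟫ shift-+ d 0ℝ A) ⟩
    id
      ≈⟨ S.unitalityʳ {d} A ⟨
    shift-coe (Real.+-identityʳ d) A
      ∘ (from (shift-+ d 0ℝ A) ∘ (Shift.F₁ d (from (shift-0 A)) ∘ id))
      ≈⟨ refl⟩∘⟨ refl⟩∘⟨ identityʳ ⟩
    shift-coe (Real.+-identityʳ d) A
      ∘ (from (shift-+ d 0ℝ A) ∘ Shift.F₁ d (from (shift-0 A))) ∎)

  coeᵗ-refl : ∀ {A} → coeᵗ (≈ᵗ-refl {A}) ≈ id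
  coeᵗ-refl {one}   = Equiv.refl
  coeᵗ-refl {‵ q}   = Equiv.refl
  coeᵗ-refl {A ⊗ B} = Equiv.trans (⊗-resp-≈ (coeᵗ-refl {A}) (coeᵗ-refl {B})) ⊗-identity
  coeᵗ-refl {□ d A} = Equiv.trans
    (shift-coe-loop Real.≃-refl ⟩∘⟨
      Equiv.trans (Shift.F-resp-≈ d (coeᵗ-refl {A})) (Shift.identity d))
    identityˡ

  coeᵈ-refl : ∀ x {d d'} A (p : d ≃ d') →
              coeᵈ (decl {x} p (≈ᵗ-refl {A})) ≈ shift-coe p ⟦ A ⟧ᵗ
  coeᵈ-refl x {d} A p = Equiv.trans
    (refl⟩∘⟨ Equiv.trans (Shift.F-resp-≈ d (coeᵗ-refl {A})) (Shift.identity d)) identityʳ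

  coeᶜ-refl : ∀ {Γ} → coeᶜ (≈ᶜ-refl {Γ}) ≈ id
  coeᶜ-refl {[]}              = Equiv.refl
  coeᶜ-refl {(x ⦂[ d ] A) ∷ Γ} = Equiv.trans
    (⊗-resp-≈ (Equiv.trans (coeᵈ-refl x A Real.≃-refl) (shift-coe-loop Real.≃-refl))
              (coeᶜ-refl {Γ}))
    ⊗-identity

  Conv-head : ∀ x {d d' A Δ t C} (p : d' ≃ d) (D : x ⦂[ d ] A ∷ Δ ⊢ t ⦂ C) →
              ⟦ Conv (decl p ≈ᵗ-refl ∷ ≈ᶜ-refl) ≈ᵗ-refl D ⟧ ≈ ⟦ D ⟧ ∘ (shift-coe p ⟦ A ⟧ᵗ ⊗₁ id)
  Conv-head x {A = A} {Δ} {C = C} p D = Equiv.trans (coeᵗ-refl {C} ⟩∘⟨refl) (Equiv.trans identityˡ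
    (refl⟩∘⟨ ⊗-resp-≈ (coeᵈ-refl x A p) (coeᶜ-refl {Δ})))

  shift-Var : ∀ x d A Δ →
              (Shift.F₁ d ⟦ Var- {x} {A} ⟧ ⊗₁ id) ∘ from (shiftAppend d (x ⦂[ 0ℝ ] A ∷ []) Δ)
              ≈ shift-coe (Real.+-identityʳ d) ⟦ A ⟧ᵗ ⊗₁ id
  shift-Var x d A Δ = begin
    (F₁ (to (shift-0 _) ∘ ρ⇒) ⊗₁ id)
      ∘ (((μ⇒ ∘ (to (shift-+ d 0ℝ _) ⊗₁ ε⇒)) ⊗₁ id) ∘ (α⇐ ∘ (id ⊗₁ λ⇐)))
      ≈⟨ pullˡ (Equiv.sym ⊗-splitˡ) ⟩
    ((F₁ (to (shift-0 _) ∘ ρ⇒) ∘ (μ⇒ ∘ (to (shift-+ d 0ℝ _) ⊗₁ ε⇒))) ⊗₁ id)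
      ∘ (α⇐ ∘ (id ⊗₁ λ⇐))
      ≈⟨ ⊗-≈ˡ absorb-unit ⟩∘⟨refl ⟩
    ((shift-coe (Real.+-identityʳ d) _ ∘ ρ⇒) ⊗₁ id) ∘ (α⇐ ∘ (id ⊗₁ λ⇐))
      ≈⟨ ⊗-splitˡ ⟩∘⟨refl ⟩
    ((shift-coe (Real.+-identityʳ d) _ ⊗₁ id) ∘ (ρ⇒ ⊗₁ id)) ∘ (α⇐ ∘ (id ⊗₁ λ⇐))
      ≈⟨ assoc ⟩
    (shift-coe (Real.+-identityʳ d) _ ⊗₁ id) ∘ ((ρ⇒ ⊗₁ id) ∘ (α⇐ ∘ (id ⊗₁ λ⇐)))
      ≈⟨ Equiv.trans (refl⟩∘⟨ triangle⁻¹) identityʳ ⟩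
    shift-coe (Real.+-identityʳ d) _ ⊗₁ id ∎
    where
    open Shift d

    absorb-unit : F₁ (to (shift-0 ⟦ A ⟧ᵗ) ∘ ρ⇒) ∘ (μ⇒ ∘ (to (shift-+ d 0ℝ _) ⊗₁ ε⇒))
                  ≈ shift-coe (Real.+-identityʳ d) _ ∘ ρ⇒
    absorb-unit = begin
      F₁ (to (shift-0 _) ∘ ρ⇒) ∘ (μ⇒ ∘ (to (shift-+ d 0ℝ _) ⊗₁ ε⇒))
        ≈⟨ homomorphism ⟩∘⟨ refl⟩∘⟨ Equiv.trans
             (⊗-resp-≈ (Equiv.sym identityˡ) (Equiv.sym identityʳ)) ⊗-homo ⟩
      (F₁ (to (shift-0 _)) ∘ F₁ ρ⇒) ∘ (μ⇒ ∘ ((id ⊗₁ ε⇒) ∘ (to (shift-+ d 0ℝ _) ⊗₁ id)))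
        ≈⟨ assoc ⟩
      F₁ (to (shift-0 _)) ∘ (F₁ ρ⇒ ∘ (μ⇒ ∘ ((id ⊗₁ ε⇒) ∘ (to (shift-+ d 0ℝ _) ⊗₁ id))))
        ≈⟨ refl⟩∘⟨ Equiv.trans (refl⟩∘⟨ Equiv.sym assoc) (pullˡ unitalityʳ) ⟩
      F₁ (to (shift-0 _)) ∘ (ρ⇒ ∘ (to (shift-+ d 0ℝ _) ⊗₁ id))
        ≈⟨ refl⟩∘⟨ unitorʳ-natural ⟩
      F₁ (to (shift-0 _)) ∘ (to (shift-+ d 0ℝ _) ∘ ρ⇒)
        ≈⟨ pullˡ (shift-+-0 d) ⟩
      shift-coe (Real.+-identityʳ d) _ ∘ ρ⇒ ∎

  shift-Var-loop : ∀ x d A Δ (p : d ≃ d + 0ℝ) →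
    ((Shift.F₁ d ⟦ Var- {x} {A} ⟧ ⊗₁ id) ∘ from (shiftAppend d (x ⦂[ 0ℝ ] A ∷ []) Δ))
      ∘ (shift-coe p ⟦ A ⟧ᵗ ⊗₁ id) ≈ id
  shift-Var-loop x d A Δ p = begin
    _                                                                ≈⟨ shift-Var x d A Δ ⟩∘⟨refl ⟩
    (shift-coe (Real.+-identityʳ d) _ ⊗₁ id) ∘ (shift-coe p _ ⊗₁ id) ≈⟨ ⊗-splitˡ ⟨
    (shift-coe (Real.+-identityʳ d) _ ∘ shift-coe p _) ⊗₁ id         ≈⟨ ⊗-≈ˡ (shift-coe-∘ p _ Real.≃-refl) ⟩
    shift-coe Real.≃-refl _ ⊗₁ id                                    ≈⟨ ⊗-≈ˡ (shift-coe-loop Real.≃-refl) ⟩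
    id ⊗₁ id                                                         ≈⟨ ⊗-identity ⟩
    id                                                               ∎

module Permutation {Sig : Signature} {o ℓ e} (M : Model Sig o ℓ e) where

  open Calculus Sig
  open Model M
  open Interpretation M
  open SymmetricCoherence 𝒞
  open HomReasoning

  permute : ∀ {Γ Γ'} → Star _⟿_ Γ Γ' → ⟦ Γ' ⟧ᶜ ⇒ ⟦ Γ ⟧ᶜ
  permute done                            = id
  permute (adjacent Γ {a} {b} {Δ} ◅ ss) = swapᶜ Γ b a Δ ∘ permute ss

  ⟦swaps⟧ : ∀ {Γ Γ' t A} (ss : Star _⟿_ Γ Γ') (D : Γ ⊢ t ⦂ A) →
            ⟦ swaps ss D ⟧ ≈ ⟦ D ⟧ ∘ permute ss
  ⟦swaps⟧ done              D = Equiv.sym identityʳ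
  ⟦swaps⟧ (adjacent Γ ◅ ss) D = Equiv.trans (⟦swaps⟧ ss (Swap Γ D)) assoc

  permute-◅◅ : ∀ {Γ Γ' Γ''} (ss : Star _⟿_ Γ Γ') (ts : Star _⟿_ Γ' Γ'') →
               permute (ss ◅◅ ts) ≈ permute ss ∘ permute ts
  permute-◅◅ done              ts = Equiv.sym identityˡ
  permute-◅◅ (adjacent Γ ◅ ss) ts = Equiv.trans (refl⟩∘⟨ permute-◅◅ ss ts) (Equiv.sym assoc)

  permute-∷ˢ : ∀ a {Γ Γ'} (ss : Star _⟿_ Γ Γ') → permute (a ∷ˢ ss) ≈ id ⊗₁ permute ss
  permute-∷ˢ a done              = Equiv.sym ⊗-identity
  permute-∷ˢ a (adjacent Γ ◅ ss) = Equiv.trans (refl⟩∘⟨ permute-∷ˢ a ss) (Equiv.sym ⊗-splitʳ)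

  -- permute is contravariant: a permutation to the front is interpreted by a
  -- morphism out of the context with the variable already at the front.
  pull : ∀ Θ a Ξ → ⟦ Θ ++ a ∷ Ξ ⟧ᶜ ⇒ ⟦ a ∷ Θ ++ Ξ ⟧ᶜ
  pull Θ a Ξ = permute (fromFront Θ a Ξ)

  push : ∀ Θ a Ξ → ⟦ a ∷ Θ ++ Ξ ⟧ᶜ ⇒ ⟦ Θ ++ a ∷ Ξ ⟧ᶜ
  push Θ a Ξ = permute (toFront Θ a Ξ)

  pull-∷ : ∀ b Θ a Ξ → pull (b ∷ Θ) a Ξ ≈ exchange ∘ (id ⊗₁ pull Θ a Ξ)
  pull-∷ b Θ a Ξ = refl⟩∘⟨ permute-∷ˢ b (fromFront Θ a Ξ)

  push-∷ : ∀ b Θ a Ξ → push (b ∷ Θ) a Ξ ≈ (id ⊗₁ push Θ a Ξ) ∘ exchange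
  push-∷ b Θ a Ξ = Equiv.trans (permute-◅◅ (b ∷ˢ toFront Θ a Ξ) (adjacent [] ◅ done))
    (permute-∷ˢ b (toFront Θ a Ξ) ⟩∘⟨ identityʳ)

  push-pull : ∀ Θ a Ξ → push Θ a Ξ ∘ pull Θ a Ξ ≈ id
  push-pull []      a Ξ = identityˡ
  push-pull (b ∷ Θ) a Ξ = begin
    push (b ∷ Θ) a Ξ ∘ pull (b ∷ Θ) a Ξ
      ≈⟨ push-∷ b Θ a Ξ ⟩∘⟨ pull-∷ b Θ a Ξ ⟩
    ((id ⊗₁ push Θ a Ξ) ∘ exchange) ∘ (exchange ∘ (id ⊗₁ pull Θ a Ξ))
      ≈⟨ Equiv.trans assoc (refl⟩∘⟨ cancelˡ exchange-involutive) ⟩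
    (id ⊗₁ push Θ a Ξ) ∘ (id ⊗₁ pull Θ a Ξ)
      ≈⟨ ⊗-splitʳ ⟨
    id ⊗₁ (push Θ a Ξ ∘ pull Θ a Ξ)
      ≈⟨ Equiv.trans (⊗-≈ʳ (push-pull Θ a Ξ)) ⊗-identity ⟩
    id ∎

  pull-unitₑ : ∀ {x d} Θ Ξ →
               from (dropUnit d ⟦ Θ ++ Ξ ⟧ᶜ) ∘ pull Θ (x ⦂[ d ] one) Ξ
               ≈ from (elim-iso (unitₑ {x} {d}) Θ Ξ)
  pull-unitₑ         []      Ξ = identityʳ
  pull-unitₑ {x} {d} (b ∷ Θ) Ξ = begin
    from (dropUnit d _) ∘ pull (b ∷ Θ) (x ⦂[ d ] one) Ξ
      ≈⟨ refl⟩∘⟨ pull-∷ b Θ _ Ξ ⟩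
    from (dropUnit d _) ∘ (exchange ∘ (id ⊗₁ pull Θ (x ⦂[ d ] one) Ξ))
      ≈⟨ pullˡ exchange-unit ⟩
    (id ⊗₁ from (dropUnit d _)) ∘ (id ⊗₁ pull Θ (x ⦂[ d ] one) Ξ)
      ≈⟨ ⊗-splitʳ ⟨
    id ⊗₁ (from (dropUnit d _) ∘ pull Θ (x ⦂[ d ] one) Ξ)
      ≈⟨ ⊗-≈ʳ (pull-unitₑ Θ Ξ) ⟩
    id ⊗₁ from (elim-iso unitₑ Θ Ξ) ∎

  pull-boxₑ : ∀ {x z d e A} Θ Ξ →
              (from (shift-+ d e ⟦ A ⟧ᵗ) ⊗₁ id) ∘ pull Θ (z ⦂[ d ] □ e A) Ξ
              ≈ pull Θ (x ⦂[ d + e ] A) Ξ ∘ from (elim-iso (boxₑ {x} {z} {d} {e} {A}) Θ Ξ)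
  pull-boxₑ []      Ξ = Equiv.trans identityʳ (Equiv.sym identityˡ)
  pull-boxₑ {x} {z} {d} {e} {A} (b ∷ Θ) Ξ = begin
    (f ⊗₁ id) ∘ pull (b ∷ Θ) (z ⦂[ d ] □ e A) Ξ
      ≈⟨ ⊗-resp-≈ Equiv.refl (Equiv.sym ⊗-identity) ⟩∘⟨ pull-∷ b Θ _ Ξ ⟩
    (f ⊗₁ (id ⊗₁ id)) ∘ (exchange ∘ (id ⊗₁ pull Θ (z ⦂[ d ] □ e A) Ξ))
      ≈⟨ extendˡ exchange-natural ⟨
    exchange ∘ ((id ⊗₁ (f ⊗₁ id)) ∘ (id ⊗₁ pull Θ (z ⦂[ d ] □ e A) Ξ))
      ≈⟨ refl⟩∘⟨ ⊗-splitʳ ⟨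
    exchange ∘ (id ⊗₁ ((f ⊗₁ id) ∘ pull Θ (z ⦂[ d ] □ e A) Ξ))
      ≈⟨ refl⟩∘⟨ ⊗-≈ʳ (pull-boxₑ Θ Ξ) ⟩
    exchange ∘ (id ⊗₁ (pull Θ (x ⦂[ d + e ] A) Ξ ∘ from (elim-iso boxₑ Θ Ξ)))
      ≈⟨ refl⟩∘⟨ ⊗-splitʳ ⟩
    exchange ∘ ((id ⊗₁ pull Θ (x ⦂[ d + e ] A) Ξ) ∘ (id ⊗₁ from (elim-iso boxₑ Θ Ξ)))
      ≈⟨ pullˡ (Equiv.sym (pull-∷ b Θ _ Ξ)) ⟩
    pull (b ∷ Θ) (x ⦂[ d + e ] A) Ξ ∘ (id ⊗₁ from (elim-iso boxₑ Θ Ξ)) ∎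
    where
    f : Shift.F₀ d (Shift.F₀ e ⟦ A ⟧ᵗ) ⇒ Shift.F₀ (d + e) ⟦ A ⟧ᵗ
    f = from (shift-+ d e ⟦ A ⟧ᵗ)

  pull₂ : ∀ Θ a b Ξ → ⟦ Θ ++ a ∷ b ∷ Ξ ⟧ᶜ ⇒ ⟦ a ∷ b ∷ Θ ++ Ξ ⟧ᶜ
  pull₂ Θ a b Ξ = (id ⊗₁ pull Θ b Ξ) ∘ pull Θ a (b ∷ Ξ)

  pull₂-∷ : ∀ c Θ a b Ξ →
            pull₂ (c ∷ Θ) a b Ξ ≈ ((id ⊗₁ exchange) ∘ exchange) ∘ (id ⊗₁ pull₂ Θ a b Ξ)
  pull₂-∷ c Θ a b Ξ = begin
    (id ⊗₁ pull (c ∷ Θ) b Ξ) ∘ pull (c ∷ Θ) a (b ∷ Ξ)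
      ≈⟨ ⊗-≈ʳ (pull-∷ c Θ b Ξ) ⟩∘⟨ pull-∷ c Θ a (b ∷ Ξ) ⟩
    (id ⊗₁ (exchange ∘ (id ⊗₁ pull Θ b Ξ))) ∘ (exchange ∘ (id ⊗₁ pull Θ a (b ∷ Ξ)))
      ≈⟨ Equiv.trans (⊗-splitʳ ⟩∘⟨refl) assoc ⟩
    (id ⊗₁ exchange) ∘ ((id ⊗₁ (id ⊗₁ pull Θ b Ξ)) ∘ (exchange ∘ (id ⊗₁ pull Θ a (b ∷ Ξ))))
      ≈⟨ refl⟩∘⟨ extendˡ exchange-natural ⟨
    (id ⊗₁ exchange) ∘ (exchange ∘ ((id ⊗₁ (id ⊗₁ pull Θ b Ξ)) ∘ (id ⊗₁ pull Θ a (b ∷ Ξ))))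
      ≈⟨ refl⟩∘⟨ refl⟩∘⟨ ⊗-splitʳ ⟨
    (id ⊗₁ exchange) ∘ (exchange ∘ (id ⊗₁ pull₂ Θ a b Ξ))
      ≈⟨ assoc ⟨
    ((id ⊗₁ exchange) ∘ exchange) ∘ (id ⊗₁ pull₂ Θ a b Ξ) ∎

  pull-tensₑ : ∀ {x y z d A B} Θ Ξ →
    from (shiftTensor d ⟦ A ⟧ᵗ ⟦ B ⟧ᵗ ⟦ Θ ++ Ξ ⟧ᶜ) ∘ pull Θ (z ⦂[ d ] (A ⊗ B)) Ξ
    ≈ pull₂ Θ (x ⦂[ d ] A) (y ⦂[ d ] B) Ξ ∘ from (elim-iso (tensₑ {x} {y} {z} {d} {A} {B}) Θ Ξ)
  pull-tensₑ [] Ξ = Equiv.trans identityʳ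
    (Equiv.sym (Equiv.trans (Equiv.trans identityʳ ⊗-identity ⟩∘⟨refl) identityˡ))
  pull-tensₑ {x} {y} {z} {d} {A} {B} (b ∷ Θ) Ξ = begin
    (α⇒ ∘ (f ⊗₁ id)) ∘ pull (b ∷ Θ) zᵈ Ξ
      ≈⟨ Equiv.trans assoc (refl⟩∘⟨ (⊗-resp-≈ Equiv.refl (Equiv.sym ⊗-identity) ⟩∘⟨ pull-∷ b Θ _ Ξ)) ⟩
    α⇒ ∘ ((f ⊗₁ (id ⊗₁ id)) ∘ (exchange ∘ (id ⊗₁ pull Θ zᵈ Ξ)))
      ≈⟨ refl⟩∘⟨ extendˡ exchange-natural ⟨
    α⇒ ∘ (exchange ∘ ((id ⊗₁ (f ⊗₁ id)) ∘ (id ⊗₁ pull Θ zᵈ Ξ)))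
      ≈⟨ extendˡ exchange-⊗ ⟩
    ((id ⊗₁ exchange) ∘ exchange) ∘ ((id ⊗₁ α⇒) ∘ ((id ⊗₁ (f ⊗₁ id)) ∘ (id ⊗₁ pull Θ zᵈ Ξ)))
      ≈⟨ refl⟩∘⟨ Equiv.trans ⊗-splitʳ (Equiv.trans (⊗-splitʳ ⟩∘⟨refl) assoc) ⟨
    ((id ⊗₁ exchange) ∘ exchange) ∘ (id ⊗₁ ((α⇒ ∘ (f ⊗₁ id)) ∘ pull Θ zᵈ Ξ))
      ≈⟨ refl⟩∘⟨ ⊗-≈ʳ (pull-tensₑ Θ Ξ) ⟩
    ((id ⊗₁ exchange) ∘ exchange) ∘ (id ⊗₁ (pull₂ Θ xᵈ yᵈ Ξ ∘ from (elim-iso tensₑ Θ Ξ)))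
      ≈⟨ refl⟩∘⟨ ⊗-splitʳ ⟩
    ((id ⊗₁ exchange) ∘ exchange) ∘ ((id ⊗₁ pull₂ Θ xᵈ yᵈ Ξ) ∘ (id ⊗₁ from (elim-iso tensₑ Θ Ξ)))
      ≈⟨ pullˡ (Equiv.sym (pull₂-∷ b Θ xᵈ yᵈ Ξ)) ⟩
    pull₂ (b ∷ Θ) xᵈ yᵈ Ξ ∘ (id ⊗₁ from (elim-iso tensₑ Θ Ξ)) ∎
    where
    xᵈ yᵈ zᵈ : Decl
    xᵈ = x ⦂[ d ] A
    yᵈ = y ⦂[ d ] B
    zᵈ = z ⦂[ d ] (A ⊗ B)
    f : Shift.F₀ d (⟦ A ⟧ᵗ ⊗₀ ⟦ B ⟧ᵗ) ⇒ (Shift.F₀ d ⟦ A ⟧ᵗ ⊗₀ Shift.F₀ d ⟦ B ⟧ᵗ)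
    f = to (Shift.μ-iso d)

module Elimination {Sig : Signature} {o ℓ e} (M : Model Sig o ℓ e) where

  open Calculus Sig
  open Model M
  open Interpretation M
  open SymmetricCoherence 𝒞
  open ShiftCoherence M
  open Permutation M
  open HomReasoning

  ⟦swaps-Conv⟧ : ∀ x {d d' A Δ Γ t C} (ss : Star _⟿_ (x ⦂[ d' ] A ∷ Δ) Γ) (p : d' ≃ d)
                 (D : x ⦂[ d ] A ∷ Δ ⊢ t ⦂ C) →
                 ⟦ swaps ss (Conv (decl p ≈ᵗ-refl ∷ ≈ᶜ-refl) ≈ᵗ-refl D) ⟧
                 ≈ (⟦ D ⟧ ∘ (shift-coe p ⟦ A ⟧ᵗ ⊗₁ id)) ∘ permute ss
  ⟦swaps-Conv⟧ x ss p D = Equiv.trans (⟦swaps⟧ ss _) (Conv-head x p D ⟩∘⟨refl)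

  ⟦unitₑ⟧ : ∀ {x d} Θ Ξ {t A} (D : Θ ++ Ξ ⊢ t ⦂ A) →
            ⟦ ⊢letₑ (unitₑ {x} {d}) Θ Ξ D ⟧ ≈ ⟦ D ⟧ ∘ from (elim-iso (unitₑ {x} {d}) Θ Ξ)
  ⟦unitₑ⟧ {x} {d} Θ Ξ {A = A} D = begin
    ⟦ ⊢letₑ unitₑ Θ Ξ D ⟧
      ≈⟨ ⟦swaps-Conv⟧ x (fromFront Θ (x ⦂[ d ] one) Ξ) _ (Unit-E d Var- D) ⟩
    ((L ∘ ((V ⊗₁ ⟦ D ⟧) ∘ S)) ∘ K) ∘ P
      ≈⟨ (refl⟩∘⟨ (Equiv.trans (⊗-resp-≈ (Equiv.sym identityˡ) (Equiv.sym identityʳ)) ⊗-homo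
                    ⟩∘⟨refl)) ⟩∘⟨refl ⟩∘⟨refl ⟩
    ((L ∘ (((id ⊗₁ ⟦ D ⟧) ∘ (V ⊗₁ id)) ∘ S)) ∘ K) ∘ P
      ≈⟨ Equiv.trans (refl⟩∘⟨ assoc) (Equiv.sym assoc) ⟩∘⟨refl ⟩∘⟨refl ⟩
    (((L ∘ (id ⊗₁ ⟦ D ⟧)) ∘ ((V ⊗₁ id) ∘ S)) ∘ K) ∘ P
      ≈⟨ Equiv.trans assoc (Equiv.trans (refl⟩∘⟨ shift-Var-loop x d one (Θ ++ Ξ) _) identityʳ) ⟩∘⟨refl ⟩
    (L ∘ (id ⊗₁ ⟦ D ⟧)) ∘ P
      ≈⟨ Equiv.trans assoc (Equiv.trans (refl⟩∘⟨ ⊗-interchange) (extendˡ unitorˡ-natural)) ⟩∘⟨refl ⟩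
    (⟦ D ⟧ ∘ L) ∘ P
      ≈⟨ assoc ⟩
    ⟦ D ⟧ ∘ (L ∘ P)
      ≈⟨ refl⟩∘⟨ pull-unitₑ Θ Ξ ⟩
    ⟦ D ⟧ ∘ from (elim-iso unitₑ Θ Ξ) ∎
    where
    L : ∀ {B} → (Shift.F₀ d unit ⊗₀ B) ⇒ B
    L {B} = from (dropUnit d B)

    V = Shift.F₁ d ⟦ Var- {x} {one} ⟧
    P = pull Θ (x ⦂[ d ] one) Ξ
    K = shift-coe (Real.≃-sym (Real.+-identityʳ d)) unit ⊗₁ id {⟦ Θ ++ Ξ ⟧ᶜ}
    S = from (shiftAppend d (x ⦂[ 0ℝ ] one ∷ []) (Θ ++ Ξ))

  ⟦tensₑ⟧ : ∀ {x y z d A B} Θ Ξ {t C} (D : Θ ++ x ⦂[ d ] A ∷ y ⦂[ d ] B ∷ Ξ ⊢ t ⦂ C) →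
            ⟦ ⊢letₑ (tensₑ {x} {y} {z} {d} {A} {B}) Θ Ξ D ⟧
            ≈ ⟦ D ⟧ ∘ from (elim-iso (tensₑ {x} {y} {z} {d} {A} {B}) Θ Ξ)
  ⟦tensₑ⟧ {x} {y} {z} {d} {A} {B} Θ Ξ D = begin
    ⟦ ⊢letₑ tensₑ Θ Ξ D ⟧
      ≈⟨ ⟦swaps-Conv⟧ z (fromFront Θ zᵈ Ξ) _ (Tens-E Var- E) ⟩
    ((⟦ E ⟧ ∘ (T ∘ V)) ∘ K) ∘ pull Θ zᵈ Ξ
      ≈⟨ Equiv.trans (Equiv.sym assoc ⟩∘⟨refl)
           (Equiv.trans assoc (Equiv.trans (refl⟩∘⟨ shift-Var-loop z d (A ⊗ B) (Θ ++ Ξ) _) identityʳ)) ⟩∘⟨refl ⟩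
    (⟦ E ⟧ ∘ T) ∘ pull Θ zᵈ Ξ
      ≈⟨ assoc ⟩
    ⟦ E ⟧ ∘ (T ∘ pull Θ zᵈ Ξ)
      ≈⟨ ⟦swaps⟧ toFront₂ D ⟩∘⟨ pull-tensₑ Θ Ξ ⟩
    (⟦ D ⟧ ∘ permute toFront₂) ∘ (pull₂ Θ xᵈ yᵈ Ξ ∘ from (elim-iso tensₑ Θ Ξ))
      ≈⟨ Equiv.trans assoc (refl⟩∘⟨ cancelˡ toFront₂-pull₂) ⟩
    ⟦ D ⟧ ∘ from (elim-iso tensₑ Θ Ξ) ∎
    where
    xᵈ yᵈ zᵈ : Decl
    xᵈ = x ⦂[ d ] A
    yᵈ = y ⦂[ d ] B
    zᵈ = z ⦂[ d ] (A ⊗ B)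

    toFront₂ : Star _⟿_ (Θ ++ xᵈ ∷ yᵈ ∷ Ξ) (xᵈ ∷ yᵈ ∷ Θ ++ Ξ)
    toFront₂ = toFront Θ xᵈ (yᵈ ∷ Ξ) ◅◅ (xᵈ ∷ˢ toFront Θ yᵈ Ξ)

    E = swaps toFront₂ D
    T = from (shiftTensor d ⟦ A ⟧ᵗ ⟦ B ⟧ᵗ ⟦ Θ ++ Ξ ⟧ᶜ)
    V = (Shift.F₁ d ⟦ Var- {z} {A ⊗ B} ⟧ ⊗₁ id) ∘ from (shiftAppend d (z ⦂[ 0ℝ ] (A ⊗ B) ∷ []) (Θ ++ Ξ))
    K = shift-coe (Real.≃-sym (Real.+-identityʳ d)) ⟦ A ⊗ B ⟧ᵗ ⊗₁ id {⟦ Θ ++ Ξ ⟧ᶜ}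

    toFront₂-pull₂ : permute toFront₂ ∘ pull₂ Θ xᵈ yᵈ Ξ ≈ id
    toFront₂-pull₂ = begin
      permute toFront₂ ∘ pull₂ Θ xᵈ yᵈ Ξ
        ≈⟨ Equiv.trans (permute-◅◅ (toFront Θ xᵈ (yᵈ ∷ Ξ)) _)
             (refl⟩∘⟨ permute-∷ˢ xᵈ (toFront Θ yᵈ Ξ)) ⟩∘⟨refl ⟩
      (push Θ xᵈ (yᵈ ∷ Ξ) ∘ (id ⊗₁ push Θ yᵈ Ξ)) ∘ ((id ⊗₁ pull Θ yᵈ Ξ) ∘ pull Θ xᵈ (yᵈ ∷ Ξ))
        ≈⟨ Equiv.trans assoc (refl⟩∘⟨ cancelˡ (Equiv.trans (Equiv.sym ⊗-splitʳ)
             (Equiv.trans (⊗-≈ʳ (push-pull Θ yᵈ Ξ)) ⊗-identity))) ⟩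
      push Θ xᵈ (yᵈ ∷ Ξ) ∘ pull Θ xᵈ (yᵈ ∷ Ξ)
        ≈⟨ push-pull Θ xᵈ (yᵈ ∷ Ξ) ⟩
      id ∎

  ⟦boxₑ⟧ : ∀ {x z d e A} Θ Ξ {t C} (D : Θ ++ x ⦂[ d + e ] A ∷ Ξ ⊢ t ⦂ C) →
           ⟦ ⊢letₑ (boxₑ {x} {z} {d} {e} {A}) Θ Ξ D ⟧
           ≈ ⟦ D ⟧ ∘ from (elim-iso (boxₑ {x} {z} {d} {e} {A}) Θ Ξ)
  ⟦boxₑ⟧ {x} {z} {d} {e} {A} Θ Ξ D = begin
    ⟦ ⊢letₑ boxₑ Θ Ξ D ⟧
      ≈⟨ ⟦swaps-Conv⟧ z (fromFront Θ zᵈ Ξ) p (Box-E Var- E) ⟩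
    ((⟦ E ⟧ ∘ ((B ⊗₁ id) ∘ V)) ∘ (shift-coe p _ ⊗₁ id)) ∘ pull Θ zᵈ Ξ
      ≈⟨ (refl⟩∘⟨ refl⟩∘⟨ shift-Var z _ (□ e A) (Θ ++ Ξ)) ⟩∘⟨refl ⟩∘⟨refl ⟩
    ((⟦ E ⟧ ∘ ((B ⊗₁ id) ∘ (shift-coe (Real.+-identityʳ _) _ ⊗₁ id))) ∘ (shift-coe p _ ⊗₁ id)) ∘ pull Θ zᵈ Ξ
      ≈⟨ Equiv.trans assoc (refl⟩∘⟨ Equiv.trans assoc (refl⟩∘⟨ Equiv.sym ⊗-splitˡ)) ⟩∘⟨refl ⟩
    (⟦ E ⟧ ∘ ((B ⊗₁ id) ∘ ((shift-coe (Real.+-identityʳ _) _ ∘ shift-coe p _) ⊗₁ id))) ∘ pull Θ zᵈ Ξ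
      ≈⟨ (refl⟩∘⟨ Equiv.trans (Equiv.sym ⊗-splitˡ) (⊗-≈ˡ regrade)) ⟩∘⟨refl ⟩
    (⟦ E ⟧ ∘ (from (shift-+ d e _) ⊗₁ id)) ∘ pull Θ zᵈ Ξ
      ≈⟨ assoc ⟩
    ⟦ E ⟧ ∘ ((from (shift-+ d e _) ⊗₁ id) ∘ pull Θ zᵈ Ξ)
      ≈⟨ ⟦swaps⟧ (toFront Θ xᵈ Ξ) D ⟩∘⟨ pull-boxₑ Θ Ξ ⟩
    (⟦ D ⟧ ∘ push Θ xᵈ Ξ) ∘ (pull Θ xᵈ Ξ ∘ from (elim-iso boxₑ Θ Ξ))
      ≈⟨ Equiv.trans assoc (refl⟩∘⟨ cancelˡ (push-pull Θ xᵈ Ξ)) ⟩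
    ⟦ D ⟧ ∘ from (elim-iso boxₑ Θ Ξ) ∎
    where
    xᵈ zᵈ : Decl
    xᵈ = x ⦂[ d + e ] A
    zᵈ = z ⦂[ d ] □ e A

    p : d ≃ ((d + e) - e) + 0ℝ
    p = Real.≃-sym (Real.≃-trans (Real.+-identityʳ _) (Real.x+y-y≃x d e))

    q : d ≃ (d + e) - e
    q = Real.≃-sym (Real.x+y-y≃x d e)

    E = swaps (toFront Θ xᵈ Ξ) D
    B = shift-coe (Real.x-y+y≃x (d + e) e) ⟦ A ⟧ᵗ ∘ from (shift-+ ((d + e) - e) e ⟦ A ⟧ᵗ)
    V = (Shift.F₁ ((d + e) - e) ⟦ Var- {z} {□ e A} ⟧ ⊗₁ id)
        ∘ from (shiftAppend ((d + e) - e) (z ⦂[ 0ℝ ] □ e A ∷ []) (Θ ++ Ξ))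

    regrade : B ∘ (shift-coe (Real.+-identityʳ _) _ ∘ shift-coe p _) ≈ from (shift-+ d e ⟦ A ⟧ᵗ)
    regrade = begin
      B ∘ (shift-coe (Real.+-identityʳ _) _ ∘ shift-coe p _)
        ≈⟨ refl⟩∘⟨ shift-coe-∘ p (Real.+-identityʳ _) q ⟩
      B ∘ shift-coe q _
        ≈⟨ assoc ⟩
      shift-coe (Real.x-y+y≃x (d + e) e) _ ∘ (from (shift-+ ((d + e) - e) e _) ∘ shift-coe q _)
        ≈⟨ refl⟩∘⟨ shift-+-coe q (Real.+-cong q Real.≃-refl) ⟩
      shift-coe (Real.x-y+y≃x (d + e) e) _ ∘ (shift-coe (Real.+-cong q Real.≃-refl) _ ∘ from (shift-+ d e _))
        ≈⟨ cancelˡ (Equiv.trans (shift-coe-∘ _ _ Real.≃-refl) (shift-coe-loop Real.≃-refl)) ⟩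
      from (shift-+ d e _) ∎

lemma20 : ∀ {o ℓ ℓ'} (Sig : Signature) (M : Model Sig o ℓ ℓ') →
          let open Calculus Sig
              open Model M
              open Interpretation M
          in ∀ {e Γ Δ} (p : Γ ⊸[ e ] Δ) (Θ Ξ : Ctx) {t A} (D : Θ ++ Δ ++ Ξ ⊢ t ⦂ A) →
             ⟦ ⊢letₑ p Θ Ξ D ⟧ ≈ ⟦ D ⟧ ∘ from (elim-iso p Θ Ξ)
lemma20 Sig M Calculus.unitₑ = Elimination.⟦unitₑ⟧ M
lemma20 Sig M Calculus.tensₑ = Elimination.⟦tensₑ⟧ M
lemma20 Sig M Calculus.boxₑ  = Elimination.⟦boxₑ⟧ M
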